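{- Every provably recursive function of $\mathbf{A}(\mathrm{PR})$ is provable with basic terms; that is, if $f:\mathbb{N}^n\to\mathbb{N}$ is a provably recursive function of $\mathbf{A}(\mathrm{PR})$, then there is a strongly coherent full program $(P,\mathsf{f})$ computing $f$ such that $\mathbf{A}(P)\vdash_{b}\forall\vec{x}\,\exists y\;\mathsf{f}(\vec{x})=y$.
   Context: For a set $P$ of first-order equations, let $\mathcal{L}$ be the language of $P$ together with a constant $\mathsf{0}$ and a unary function symbol $\mathsf{S}$. The theory $\mathbf{A}(P)$ is the first-order theory with equality in $\mathcal{L}$ whose axioms are: the universal closures of the equations in $P$; the separation axioms $\forall x\;\mathsf{S}(x)\neq\mathsf{0}$ and $\forall x,y\;(\mathsf{S}(x)=\mathsf{S}(y)\to x=y)$; and induction $A[\mathsf{0}]\to\forall x\,(A[x]\to A[\mathsf{S}(x)])\to\forall x\,A[x]$ for every formula $A$ of $\mathcal{L}$. Derivations use classical natural deduction with the usual quantifier rules plus the equality rules (from $A[t]$ and $t=s$ infer $A[s]$; $t=t$ is an axiom). $\mathrm{PR}$ is the set of standard defining equations of all primitive recursive functions; $\mathbf{A}(\mathrm{PR})$ is Peano Arithmetic with all primitive recursive function symbols. A function $f$ is provably recursive in $\mathbf{A}(\mathrm{PR})$ if $\mathbf{A}(\mathrm{PR})\vdash\forall\vec{x}\,\exists y\;T(e,\vec{x},y)$ for the code $e$ of some deterministic Turing machine computing $f$, where $T(e,\vec x,y)$ is the arithmetic formula expressing that the machine with code $e$ terminates on inputs $\vec x$ with computation trace coded by $y$.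 A program is a pair $(P,\mathsf{f})$ of a set of equations $P$ and a function symbol $\mathsf f$ occurring in $P$. $P\vdash_{=}E$ means the equation $E$ is derivable from $P$ in equational logic (rules: members of $P$; $t=t$; substitution of an arbitrary term for a variable; from $s[t]=r[t]$ and $t=t'$ infer $s[t']=r[t']$). The relation computed by $(P,\mathsf f)$ is $\{(\vec n,m)\mid P\vdash_{=}\mathsf f(\vec{\bar n})=\bar m\}$, where $\bar n$ is the numeral $\mathsf S^n(\mathsf 0)$. $P$ is strongly coherent if $\mathbf{A}(P)$ is consistent. $P$ is full if whenever $P$ contains a function symbol corresponding to a primitive recursive function, it also contains all the $\mathrm{PR}$ defining equations for that function. A term is basic if built from $\mathsf 0$, $\mathsf S$ and variables only. $T\vdash_b A$ means $A$ has a classical natural deduction derivation in $T$ in which every term used in a $\forall$-elimination or $\exists$-introduction is basic. -}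

module Defs where

open import Data.Nat using (ℕ; zero; suc; _⊔_; _∸_; _≡ᵇ_)
open import Data.Fin using (Fin; zero; suc; toℕ)
open import Data.Vec using (Vec; []; _∷_; map; lookup; tabulate)
open import Data.List using (List; []; _∷_) renaming (map to mapL)
open import Data.List.Membership.Propositional using (_∈_)
open import Data.Product using (Σ; _×_; _,_)
open import Data.Sum using (_⊎_)
open import Data.Unit using (⊤)
open import Data.Empty using (⊥)
open import Data.Bool using (if_then_else_)
open import Relation.Binary.PropositionalEquality using (_≡_; refl)
open import Relation.Nullary using (¬_)

data PR : ℕ → Set where
  Z  : PR 0
  Sc : PR 1
  Pj : ∀ {n} → Fin n → PR n
  C  : ∀ {k n} → PR k → Vec (PR n) k → PR n
  R  : ∀ {n} → PR n → PR (suc (suc n)) → PR (suc n)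

mutual
  eval : ∀ {n} → PR n → Vec ℕ n → ℕ
  eval Z xs = 0
  eval Sc (x ∷ []) = suc x
  eval (Pj i) xs = lookup xs i
  eval (C g hs) xs = eval g (evalV hs xs)
  eval (R g h) (zero ∷ xs) = eval g xs
  eval (R g h) (suc y ∷ xs) = eval h (y ∷ eval (R g h) (y ∷ xs) ∷ xs)

  evalV : ∀ {k n} → Vec (PR n) k → Vec ℕ n → Vec ℕ k
  evalV [] xs = []
  evalV (h ∷ hs) xs = eval h xs ∷ evalV hs xs

-- 2. A small library of concrete PR codes (used to build Kleene's T).
--    Boolean convention: a predicate "holds" iff its value is 0.

K0 : ∀ {n} → PR n
K0 = C Z []

S' : ∀ {n} → PR n → PR n
S' a = C Sc (a ∷ [])

K1 : ∀ {n} → PR n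
K1 = S' K0

ap1 : ∀ {n} → PR 1 → PR n → PR n
ap1 f a = C f (a ∷ [])

ap2 : ∀ {n} → PR 2 → PR n → PR n → PR n
ap2 f a b = C f (a ∷ b ∷ [])

ap3 : ∀ {n} → PR 3 → PR n → PR n → PR n → PR n
ap3 f a b c = C f (a ∷ b ∷ c ∷ [])

v0 : ∀ {n} → PR (suc n)
v0 = Pj zero
v1 : ∀ {n} → PR (suc (suc n))
v1 = Pj (suc zero)
v2 : ∀ {n} → PR (suc (suc (suc n)))
v2 = Pj (suc (suc zero))
v3 : ∀ {n} → PR (suc (suc (suc (suc n))))
v3 = Pj (suc (suc (suc zero)))

addC : PR 2
addC = R v0 (S' v1)
mulC : PR 2
mulC = R K0 (ap2 addC v1 v2)
predC : PR 1
predC = R Z v0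
dsubC : PR 2     -- dsub(y,x) = x ∸ y
dsubC = R v0 (ap1 predC v1)
sgC : PR 1
sgC = R Z K1
nsgC : PR 1
nsgC = R K1 K0

infixl 6 _⊕_ _⊖_
infixl 7 _⊗_
_⊕_ _⊗_ _⊖_ : ∀ {n} → PR n → PR n → PR n
a ⊕ b = ap2 addC a b
a ⊗ b = ap2 mulC a b
a ⊖ b = ap2 dsubC b a

sg nsg : ∀ {n} → PR n → PR n
sg = ap1 sgC
nsg = ap1 nsgC

eqP ltP : ∀ {n} → PR n → PR n → PR n
eqP a b = (a ⊖ b) ⊕ (b ⊖ a)
ltP a b = S' a ⊖ b

cond : ∀ {n} → PR n → PR n → PR n → PR n
cond c a b = a ⊗ nsg c ⊕ b ⊗ sg c

params : ∀ {n} → Vec (PR (suc (suc n))) n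
params = tabulate (λ i → Pj (suc (suc i)))

-- bounded minimisation: mu p (b,x⃗) = least z < b with p(z,x⃗) = 0, else b
mu : ∀ {n} → PR (suc n) → PR (suc n)
mu p = R K0 (cond (ltP v1 v0) v1 (cond (C p (v0 ∷ params)) v0 (S' v0)))

bsum : ∀ {n} → PR (suc n) → PR (suc n)
bsum q = R K0 (v1 ⊕ C q (v0 ∷ params))

pairP : ∀ {n} → PR n → PR n → PR n
pairP a b = (a ⊕ b) ⊗ (a ⊕ b) ⊕ a

g2C : PR 2   -- g2(a,z) = least b ≤ z with ⟨a,b⟩ = z, else z+1
g2C = C (mu (eqP (pairP v1 v0) v2)) (S' v1 ∷ v0 ∷ v1 ∷ [])
fstC : PR 1
fstC = C (mu (ltP (ap2 g2C v0 v1) (S' v1))) (S' v0 ∷ v0 ∷ [])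
sndC : PR 1
sndC = ap2 g2C (ap1 fstC v0) v0

fstP sndP predP : ∀ {n} → PR n → PR n
fstP = ap1 fstC
sndP = ap1 sndC
predP = ap1 predC

-- lists: nil = 0, cons(a,l) = ⟨a,l⟩ + 1
hdP tlP : ∀ {n} → PR n → PR n
hdP l = fstP (predP l)
tlP l = sndP (predP l)

iterC : PR 2
iterC = R v0 (tlP v1)
lenC : PR 1      -- least i ≤ l with tl^i(l) = 0, else l+1
lenC = C (mu iterC) (S' v0 ∷ v0 ∷ [])

nthP : ∀ {n} → PR n → PR n → PR n
nthP l i = hdP (ap2 iterC i l)

-- Turing machines over tape alphabet {0,1} (0 = blank).
-- configuration ⟨q,⟨l,⟨s,r⟩⟩⟩: state q, scanned symbol s, tape left of
-- head l and right of head r, each as a binary number whose least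
-- significant bit is the cell adjacent to the head.
-- A machine code e is a list of transitions ⟨q,⟨s,⟨q',⟨s',d⟩⟩⟩⟩
-- ("in state q reading s, write sg(s'), go to state q', move left if
-- d = 0 and right otherwise"); the first matching transition is used,
-- so every code denotes a deterministic machine.  The machine halts
-- when no transition matches.  Start state 0.
cfgP : ∀ {n} → PR n → PR n → PR n → PR n → PR n
cfgP q l s r = pairP q (pairP l (pairP s r))

stP lfP hsP rtP : ∀ {n} → PR n → PR n
stP c = fstP c
lfP c = fstP (sndP c)
hsP c = fstP (sndP (sndP c))
rtP c = sndP (sndP (sndP c))

tqP tsP tq'P ts'P tdP : ∀ {n} → PR n → PR n
tqP t = fstP t
tsP t = fstP (sndP t)
tq'P t = fstP (sndP (sndP t))
ts'P t = fstP (sndP (sndP (sndP t)))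
tdP t = sndP (sndP (sndP (sndP t)))

lookupC : PR 3   -- (e,q,s) ↦ index of first transition for (q,s), or len e
lookupC = C (mu (eqP (tqP (nthP v1 v0)) v2 ⊕ eqP (tsP (nthP v1 v0)) v3))
            (ap1 lenC v0 ∷ v0 ∷ v1 ∷ v2 ∷ [])

haltedC : PR 2
haltedC = eqP (ap3 lookupC v0 (stP v1) (hsP v1)) (ap1 lenC v0)

mod2C div2C pow2C : PR 1
mod2C = R Z (nsg v1)
div2C = R Z (v1 ⊕ ap1 mod2C v0)
pow2C = R K1 (v1 ⊕ v1)

stepC : PR 2
stepC = cond d left right
  where
  t = nthP v0 (ap3 lookupC v0 (stP v1) (hsP v1))
  q' = tq'P t
  w = sg (ts'P t)
  d = tdP t
  l = lfP v1
  r = rtP v1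
  left  = cfgP q' (ap1 div2C l) (ap1 mod2C l) (r ⊕ r ⊕ w)
  right = cfgP q' (l ⊕ l ⊕ w) (ap1 mod2C r) (ap1 div2C r)

-- tape 1^{x1+1} 0 1^{x2+1} 0 ... 0 1^{xn+1} as a binary number
encP : ∀ {m k} → Vec (PR m) k → PR m
encP [] = K0
encP (a ∷ as) = (ap1 pow2C (S' a) ⊖ K1) ⊕ ap1 pow2C (S' (S' a)) ⊗ encP as

-- Kleene's T predicate, arguments (e, y, x1, …, xn):
-- value 0 iff y codes the list of configurations of the computation of
-- machine e on input x⃗ from the initial configuration up to and
-- including the first halting configuration.
TC : (n : ℕ) → PR (suc (suc n))
TC n = ap2 iterC L y ⊕ nsg L ⊕ eqP (nthP y K0) init
       ⊕ C (bsum q) ((L ⊖ K1) ∷ e ∷ y ∷ [])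
       ⊕ ap2 haltedC e (nthP y (L ⊖ K1))
  where
  e = v0
  y = v1
  N = encP params
  init = cfgP K0 K0 (ap1 mod2C N) (ap1 div2C N)
  L = ap1 lenC y
  q : PR 3     -- (i,e,y)
  q = nsg (ap2 haltedC v1 (nthP v2 v0))
      ⊕ eqP (nthP v2 (S' v0)) (ap2 stepC v1 (nthP v2 v0))

-- output extraction: the output m is represented by m+1 consecutive 1s
-- starting at the head in the final configuration (0 if head reads 0)
countC : PR 1    -- number of trailing 1 bits of r
countC = C (mu (ap1 mod2C (ap2 (R v0 (ap1 div2C v1)) v0 v1))) (S' v0 ∷ v0 ∷ [])

UC : PR 1
UC = cond (hsP last) K0 (ap1 countC (rtP last))
  where last = nthP v0 (ap1 lenC v0 ⊖ K1)

TMComputes : (n : ℕ) → ℕ → (Vec ℕ n → ℕ) → Set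
TMComputes n e f = (xs : Vec ℕ n) →
  Σ ℕ (λ y → (eval (TC n) (e ∷ y ∷ xs) ≡ 0) × (eval UC (y ∷ []) ≡ f xs))

data Sym : Set where
  𝟘 𝕊 : Sym
  prf : ∀ {n} → PR n → Sym
  usr : (name arity : ℕ) → Sym

arity : Sym → ℕ
arity 𝟘 = 0
arity 𝕊 = 1
arity (prf {n} _) = n
arity (usr _ k) = k

data Term : Set where
  var : ℕ → Term
  app : (f : Sym) → Vec Term (arity f) → Term

mutual
  substT : (ℕ → Term) → Term → Term
  substT σ (var x) = σ x
  substT σ (app f ts) = app f (substV σ ts)

  substV : ∀ {k} → (ℕ → Term) → Vec Term k → Vec Term k
  substV σ [] = []
  substV σ (t ∷ ts) = substT σ t ∷ substV σ ts

mutual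
  maxVarT : Term → ℕ          -- 1 + largest variable index (0 if none)
  maxVarT (var x) = suc x
  maxVarT (app f ts) = maxVarV ts

  maxVarV : ∀ {k} → Vec Term k → ℕ
  maxVarV [] = 0
  maxVarV (t ∷ ts) = maxVarT t ⊔ maxVarV ts

mutual
  OccT : Sym → Term → Set
  OccT f (var _) = ⊥
  OccT f (app g ts) = (g ≡ f) ⊎ OccV f ts

  OccV : ∀ {k} → Sym → Vec Term k → Set
  OccV f [] = ⊥
  OccV f (t ∷ ts) = OccT f t ⊎ OccV f ts

mutual
  AllSymT : (Sym → Set) → Term → Set
  AllSymT Q (var _) = ⊤
  AllSymT Q (app f ts) = Q f × AllSymV Q ts

  AllSymV : ∀ {k} → (Sym → Set) → Vec Term k → Set
  AllSymV Q [] = ⊤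
  AllSymV Q (t ∷ ts) = AllSymT Q t × AllSymV Q ts

zeroT : Term
zeroT = app 𝟘 []

sucT : Term → Term
sucT t = app 𝕊 (t ∷ [])

numeral : ℕ → Term
numeral zero = zeroT
numeral (suc n) = sucT (numeral n)

Basic : Term → Set
Basic = AllSymT (λ f → (f ≡ 𝟘) ⊎ (f ≡ 𝕊))

appV : (f : Sym) {n : ℕ} → arity f ≡ n → Vec Term n → Term
appV f refl ts = app f ts

vars : (n : ℕ) → Vec Term n
vars n = tabulate (λ i → var (toℕ i))

record Equation : Set where
  constructor _≈_
  field
    lhs rhs : Term
open Equation public

OccursIn : (Equation → Set) → Sym → Set
OccursIn P f = Σ Equation (λ E → P E × (OccT f (lhs E) ⊎ OccT f (rhs E)))

_[_≔_] : Term → ℕ → Term → Term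
s [ x ≔ t ] = substT (λ y → if y ≡ᵇ x then t else var y) s

data _⊢₌_ (P : Equation → Set) : Equation → Set where
  mem   : ∀ {E} → P E → P ⊢₌ E
  refl₌ : ∀ {t} → P ⊢₌ (t ≈ t)
  sub   : ∀ {s r} (x : ℕ) (t : Term) → P ⊢₌ (s ≈ r) →
          P ⊢₌ ((s [ x ≔ t ]) ≈ (r [ x ≔ t ]))
  rep   : ∀ (s r : Term) (x : ℕ) {t t'} →
          P ⊢₌ ((s [ x ≔ t ]) ≈ (r [ x ≔ t ])) → P ⊢₌ (t ≈ t') →
          P ⊢₌ ((s [ x ≔ t' ]) ≈ (r [ x ≔ t' ]))

Computes : (P : Equation → Set) (g : Sym) {n : ℕ} → arity g ≡ n →
           (Vec ℕ n → ℕ) → Set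
Computes P g eq f = ∀ ns m →
  ((P ⊢₌ (appV g eq (map numeral ns) ≈ numeral m)) → f ns ≡ m) ×
  (f ns ≡ m → P ⊢₌ (appV g eq (map numeral ns) ≈ numeral m))

data DefEq : ∀ {n} → PR n → Equation → Set where
  dZ : DefEq Z (app (prf Z) [] ≈ zeroT)
  dS : DefEq Sc (app (prf Sc) (var 0 ∷ []) ≈ sucT (var 0))
  dP : ∀ {n} (i : Fin n) → DefEq (Pj i) (app (prf (Pj i)) (vars n) ≈ lookup (vars n) i)
  dC : ∀ {k n} (g : PR k) (hs : Vec (PR n) k) →
       DefEq (C g hs) (app (prf (C g hs)) (vars n) ≈
                       app (prf g) (map (λ h → app (prf h) (vars n)) hs))
  dR0 : ∀ {n} (g : PR n) (h : PR (suc (suc n))) →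
        DefEq (R g h) (app (prf (R g h)) (zeroT ∷ vars n) ≈ app (prf g) (vars n))
  dR1 : ∀ {n} (g : PR n) (h : PR (suc (suc n))) →
        DefEq (R g h) (app (prf (R g h)) (sucT (var n) ∷ vars n) ≈
                       app (prf h) (var n ∷ app (prf (R g h)) (var n ∷ vars n) ∷ vars n))

PReqs : Equation → Set
PReqs E = Σ ℕ (λ n → Σ (PR n) (λ c → DefEq c E))

Full : (Equation → Set) → Set
Full P = ∀ {n} (c : PR n) → OccursIn P (prf c) → ∀ E → DefEq c E → P E

infixr 5 _⇒_
infix 7 _≐_
data Form : Set where
  _≐_ : Term → Term → Form
  ⊥'  : Form
  _⇒_ _∧'_ _∨'_ : Form → Form → Form
  all' ex' : Form → Form

lift : (ℕ → Term) → ℕ → Term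
lift σ zero = var zero
lift σ (suc i) = substT (λ j → var (suc j)) (σ i)

substF : (ℕ → Term) → Form → Form
substF σ (t ≐ s) = substT σ t ≐ substT σ s
substF σ ⊥' = ⊥'
substF σ (A ⇒ B) = substF σ A ⇒ substF σ B
substF σ (A ∧' B) = substF σ A ∧' substF σ B
substF σ (A ∨' B) = substF σ A ∨' substF σ B
substF σ (all' A) = all' (substF (lift σ) A)
substF σ (ex' A) = ex' (substF (lift σ) A)

↑ : Form → Form
↑ = substF (λ j → var (suc j))

σ₀ : Term → ℕ → Term
σ₀ t zero = t
σ₀ t (suc i) = var i

_[_] : Form → Term → Form
A [ t ] = substF (σ₀ t) A

AllSymF : (Sym → Set) → Form → Set
AllSymF Q (t ≐ s) = AllSymT Q t × AllSymT Q s
AllSymF Q ⊥' = ⊤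
AllSymF Q (A ⇒ B) = AllSymF Q A × AllSymF Q B
AllSymF Q (A ∧' B) = AllSymF Q A × AllSymF Q B
AllSymF Q (A ∨' B) = AllSymF Q A × AllSymF Q B
AllSymF Q (all' A) = AllSymF Q A
AllSymF Q (ex' A) = AllSymF Q A

all^ : ℕ → Form → Form
all^ zero A = A
all^ (suc k) A = all' (all^ k A)

InLang : (Equation → Set) → Sym → Set
InLang P f = (f ≡ 𝟘) ⊎ (f ≡ 𝕊) ⊎ OccursIn P f

σS : ℕ → Term
σS zero = sucT (var zero)
σS (suc i) = var (suc i)

Ind : Form → Form
Ind A = (A [ zeroT ]) ⇒ all' (A ⇒ substF σS A) ⇒ all' A

data AxA (P : Equation → Set) : Form → Set where
  eqAx : ∀ {E} → P E → AxA P (all^ (maxVarT (lhs E) ⊔ maxVarT (rhs E)) (lhs E ≐ rhs E))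
  sep1 : AxA P (all' ((sucT (var 0) ≐ zeroT) ⇒ ⊥'))
  sep2 : AxA P (all' (all' ((sucT (var 1) ≐ sucT (var 0)) ⇒ (var 1 ≐ var 0))))
  ind  : ∀ {A} → AllSymF (InLang P) A → AxA P (Ind A)

-- classical natural deduction with equality; Ok restricts the terms
-- allowed in ∀-elimination and ∃-introduction
data Der (Ax : Form → Set) (Ok : Term → Set) : List Form → Form → Set where
  ax   : ∀ {Γ A} → Ax A → Der Ax Ok Γ A
  hyp  : ∀ {Γ A} → A ∈ Γ → Der Ax Ok Γ A
  ⇒I   : ∀ {Γ A B} → Der Ax Ok (A ∷ Γ) B → Der Ax Ok Γ (A ⇒ B)
  ⇒E   : ∀ {Γ A B} → Der Ax Ok Γ (A ⇒ B) → Der Ax Ok Γ A → Der Ax Ok Γ B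
  ∧I   : ∀ {Γ A B} → Der Ax Ok Γ A → Der Ax Ok Γ B → Der Ax Ok Γ (A ∧' B)
  ∧E₁  : ∀ {Γ A B} → Der Ax Ok Γ (A ∧' B) → Der Ax Ok Γ A
  ∧E₂  : ∀ {Γ A B} → Der Ax Ok Γ (A ∧' B) → Der Ax Ok Γ B
  ∨I₁  : ∀ {Γ A B} → Der Ax Ok Γ A → Der Ax Ok Γ (A ∨' B)
  ∨I₂  : ∀ {Γ A B} → Der Ax Ok Γ B → Der Ax Ok Γ (A ∨' B)
  ∨E   : ∀ {Γ A B C} → Der Ax Ok Γ (A ∨' B) → Der Ax Ok (A ∷ Γ) C →
         Der Ax Ok (B ∷ Γ) C → Der Ax Ok Γ C
  ⊥E   : ∀ {Γ A} → Der Ax Ok Γ ⊥' → Der Ax Ok Γ A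
  raa  : ∀ {Γ A} → Der Ax Ok ((A ⇒ ⊥') ∷ Γ) ⊥' → Der Ax Ok Γ A
  ∀I   : ∀ {Γ A} → Der Ax Ok (mapL ↑ Γ) A → Der Ax Ok Γ (all' A)
  ∀E   : ∀ {Γ A} (t : Term) → Ok t → Der Ax Ok Γ (all' A) → Der Ax Ok Γ (A [ t ])
  ∃I   : ∀ {Γ A} (t : Term) → Ok t → Der Ax Ok Γ (A [ t ]) → Der Ax Ok Γ (ex' A)
  ∃E   : ∀ {Γ A C} → Der Ax Ok Γ (ex' A) → Der Ax Ok (A ∷ mapL ↑ Γ) (↑ C) →
         Der Ax Ok Γ C
  =refl : ∀ {Γ t} → Der Ax Ok Γ (t ≐ t)
  =E   : ∀ {Γ} (A : Form) {t s} → Der Ax Ok Γ (A [ t ]) → Der Ax Ok Γ (t ≐ s) →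
         Der Ax Ok Γ (A [ s ])

_⊢_ : (Equation → Set) → Form → Set
P ⊢ A = Der (AxA P) (AllSymT (InLang P)) [] A

_⊢b_ : (Equation → Set) → Form → Set
P ⊢b A = Der (AxA P) Basic [] A

StronglyCoherent : (Equation → Set) → Set
StronglyCoherent P = ¬ (P ⊢ ⊥')

-- variables x1,…,xn under the prefix ∀x1…∀xn∃y (y is variable 0)
xvars : (n : ℕ) → Vec Term n
xvars n = tabulate (λ i → var (n ∸ toℕ i))

Tform : (n : ℕ) → ℕ → Form
Tform n e = app (prf (TC n)) (numeral e ∷ var 0 ∷ xvars n) ≐ zeroT

ProvablyRecursive : (n : ℕ) → (Vec ℕ n → ℕ) → Set
ProvablyRecursive n f =
  Σ ℕ (λ e → TMComputes n e f × (PReqs ⊢ all^ n (ex' (Tform n e))))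

Total : (g : Sym) {n : ℕ} → arity g ≡ n → Form
Total g {n} eq = all^ n (ex' (appV g eq (xvars n) ≐ var 0))

-- Let e code a machine computing f and let 𝐀(PR) prove ∀x⃗∃y T(e,x⃗,y).  The
-- program P consists of the PR equations, the graph g(n̄⃗) = f(n⃗), and
--     g(x⃗) = k(T(e,y,x⃗), y, x⃗)        k(0, y, x⃗) = U(y)
-- for fresh symbols g, k.  Every PR symbol is provably total in 𝐀(P) with
-- basic terms (induction on its code, using the induction axiom for
-- recursion), so ∀-eliminations and ∃-introductions at PR terms in the given
-- proof can be replaced by ones at variables; this gives a basic proof of
-- ∀x⃗∃y T(e,x⃗,y) = 0, and the equations for g turn it into ∀x⃗∃y g(x⃗) = y.
-- Strong coherence and the fact that P computes exactly f come from soundness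
-- in the standard model with g = f and k(0,y,x⃗) = U(y), which is a model of P
-- because the coded computation is deterministic.
module Submission where

open import Defs
open import Data.Nat using (ℕ; zero; suc; pred; _+_; _∸_; _⊔_; _≤_; _<_; s≤s; _≟_; _≡ᵇ_)
open import Data.Nat.Properties
  using (m⊔n≤o⇒m≤o; m⊔n≤o⇒n≤o; ≤-refl; <⇒≤; +-suc; +-identityʳ; m<1+n⇒m<n∨m≡n;
         <-cmp; suc-injective; m∸n≡0⇒m≤n; ≤-antisym; pred[m∸n]≡m∸[1+n])
open import Data.Fin using (Fin; toℕ) renaming (zero to fzero; suc to fsuc)
open import Data.Fin.Properties using (toℕ<n)
open import Data.Vec using (Vec; []; _∷_; _∷ʳ_; map; lookup; tabulate)
open import Data.Vec.Relation.Unary.All using (All; []; _∷_)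
open import Data.Vec.Relation.Unary.All.Properties using (tabulate⁺)
open import Data.Vec.Properties using (lookup∘tabulate; tabulate-cong; tabulate∘lookup; ∷-injectiveˡ; ∷-injectiveʳ)
open import Data.List using (List; []; _∷_) renaming (map to mapL)
open import Data.List.Membership.Propositional using (_∈_)
open import Data.List.Membership.Propositional.Properties using (∈-map⁺)
open import Data.List.Relation.Unary.Any using (here; there)
open import Data.List.Relation.Binary.Subset.Propositional using (_⊆_)
open import Data.List.Relation.Binary.Subset.Propositional.Properties using (map⁺; ∷⁺ʳ; xs⊆x∷xs)
open import Data.Product using (Σ; _×_; _,_; proj₁; proj₂)
open import Data.Sum using (_⊎_; inj₁; inj₂)
open import Data.Unit using (tt)
open import Data.Empty using (⊥; ⊥-elim)
open import Data.Bool using (true; false; if_then_else_)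
open import Function.Bundles using (_⇔_; mk⇔; module Equivalence)
open import Relation.Nullary using (¬_; yes; no)
open import Relation.Binary using (tri<; tri≈; tri>)
open import Relation.Binary.PropositionalEquality
  using (_≡_; refl; sym; trans; cong; cong₂; subst)
open Equivalence using (to; from)

module SubstitutionAlgebra where

  Subst : Set
  Subst = ℕ → Term

  _≗ₛ_ : Subst → Subst → Set
  σ ≗ₛ τ = ∀ i → σ i ≡ τ i

  _∘ₛ_ : Subst → Subst → Subst
  (σ ∘ₛ τ) i = substT σ (τ i)

  shift : Subst
  shift i = var (suc i)

  mutual
    substT-ext : ∀ {σ τ} → σ ≗ₛ τ → ∀ t → substT σ t ≡ substT τ t
    substT-ext e (var x) = e x
    substT-ext e (app f ts) = cong (app f) (substV-ext e ts)

    substV-ext : ∀ {σ τ k} → σ ≗ₛ τ → (ts : Vec Term k) → substV σ ts ≡ substV τ ts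
    substV-ext e [] = refl
    substV-ext e (t ∷ ts) = cong₂ _∷_ (substT-ext e t) (substV-ext e ts)

  mutual
    substT-comp : ∀ σ τ t → substT σ (substT τ t) ≡ substT (σ ∘ₛ τ) t
    substT-comp σ τ (var x) = refl
    substT-comp σ τ (app f ts) = cong (app f) (substV-comp σ τ ts)

    substV-comp : ∀ {k} σ τ (ts : Vec Term k) → substV σ (substV τ ts) ≡ substV (σ ∘ₛ τ) ts
    substV-comp σ τ [] = refl
    substV-comp σ τ (t ∷ ts) = cong₂ _∷_ (substT-comp σ τ t) (substV-comp σ τ ts)

  mutual
    substT-id : ∀ t → substT var t ≡ t
    substT-id (var x) = refl
    substT-id (app f ts) = cong (app f) (substV-id ts)

    substV-id : ∀ {k} (ts : Vec Term k) → substV var ts ≡ ts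
    substV-id [] = refl
    substV-id (t ∷ ts) = cong₂ _∷_ (substT-id t) (substV-id ts)

  lift-ext : ∀ {σ τ} → σ ≗ₛ τ → lift σ ≗ₛ lift τ
  lift-ext e zero = refl
  lift-ext e (suc i) = cong (substT shift) (e i)

  lift-comp : ∀ σ τ → (lift σ ∘ₛ lift τ) ≗ₛ lift (σ ∘ₛ τ)
  lift-comp σ τ zero = refl
  lift-comp σ τ (suc i) = trans (substT-comp (lift σ) shift (τ i)) (sym (substT-comp shift σ (τ i)))

  lift-id : lift var ≗ₛ var
  lift-id zero = refl
  lift-id (suc i) = refl

  substF-ext : ∀ {σ τ} → σ ≗ₛ τ → ∀ A → substF σ A ≡ substF τ A
  substF-ext e (t ≐ s) = cong₂ _≐_ (substT-ext e t) (substT-ext e s)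
  substF-ext e ⊥' = refl
  substF-ext e (A ⇒ B) = cong₂ _⇒_ (substF-ext e A) (substF-ext e B)
  substF-ext e (A ∧' B) = cong₂ _∧'_ (substF-ext e A) (substF-ext e B)
  substF-ext e (A ∨' B) = cong₂ _∨'_ (substF-ext e A) (substF-ext e B)
  substF-ext e (all' A) = cong all' (substF-ext (lift-ext e) A)
  substF-ext e (ex' A) = cong ex' (substF-ext (lift-ext e) A)

  substF-comp : ∀ σ τ A → substF σ (substF τ A) ≡ substF (σ ∘ₛ τ) A
  substF-comp σ τ (t ≐ s) = cong₂ _≐_ (substT-comp σ τ t) (substT-comp σ τ s)
  substF-comp σ τ ⊥' = refl
  substF-comp σ τ (A ⇒ B) = cong₂ _⇒_ (substF-comp σ τ A) (substF-comp σ τ B)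
  substF-comp σ τ (A ∧' B) = cong₂ _∧'_ (substF-comp σ τ A) (substF-comp σ τ B)
  substF-comp σ τ (A ∨' B) = cong₂ _∨'_ (substF-comp σ τ A) (substF-comp σ τ B)
  substF-comp σ τ (all' A) =
    cong all' (trans (substF-comp (lift σ) (lift τ) A) (substF-ext (lift-comp σ τ) A))
  substF-comp σ τ (ex' A) =
    cong ex' (trans (substF-comp (lift σ) (lift τ) A) (substF-ext (lift-comp σ τ) A))

  substF-id : ∀ A → substF var A ≡ A
  substF-id (t ≐ s) = cong₂ _≐_ (substT-id t) (substT-id s)
  substF-id ⊥' = refl
  substF-id (A ⇒ B) = cong₂ _⇒_ (substF-id A) (substF-id B)
  substF-id (A ∧' B) = cong₂ _∧'_ (substF-id A) (substF-id B)
  substF-id (A ∨' B) = cong₂ _∨'_ (substF-id A) (substF-id B)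
  substF-id (all' A) = cong all' (trans (substF-ext lift-id A) (substF-id A))
  substF-id (ex' A) = cong ex' (trans (substF-ext lift-id A) (substF-id A))

  substT-fuse : ∀ σ τ ρ → (σ ∘ₛ τ) ≗ₛ ρ → ∀ t → substT σ (substT τ t) ≡ substT ρ t
  substT-fuse σ τ ρ e t = trans (substT-comp σ τ t) (substT-ext e t)

  substV-fuse : ∀ {k} σ τ ρ → (σ ∘ₛ τ) ≗ₛ ρ → (ts : Vec Term k) → substV σ (substV τ ts) ≡ substV ρ ts
  substV-fuse σ τ ρ e ts = trans (substV-comp σ τ ts) (substV-ext e ts)

  substF-fuse : ∀ σ τ ρ → (σ ∘ₛ τ) ≗ₛ ρ → ∀ A → substF σ (substF τ A) ≡ substF ρ A
  substF-fuse σ τ ρ e A = trans (substF-comp σ τ A) (substF-ext e A)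

  inst-shiftT : ∀ u t → substT (σ₀ u) (substT shift t) ≡ t
  inst-shiftT u t = trans (substT-fuse (σ₀ u) shift var (λ _ → refl) t) (substT-id t)

  inst-shiftV : ∀ {k} u (ts : Vec Term k) → substV (σ₀ u) (substV shift ts) ≡ ts
  inst-shiftV u ts = trans (substV-fuse (σ₀ u) shift var (λ _ → refl) ts) (substV-id ts)

  subst-inst : ∀ σ t A → substF σ (A [ t ]) ≡ (substF (lift σ) A) [ substT σ t ]
  subst-inst σ t A =
    trans (substF-fuse σ (σ₀ t) (σ₀ (substT σ t) ∘ₛ lift σ) pointwise A)
          (sym (substF-comp (σ₀ (substT σ t)) (lift σ) A))
    where
    pointwise : (σ ∘ₛ σ₀ t) ≗ₛ (σ₀ (substT σ t) ∘ₛ lift σ)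
    pointwise zero = refl
    pointwise (suc i) = sym (inst-shiftT (substT σ t) (σ i))

  lift-shiftT : ∀ σ t → substT (lift σ) (substT shift t) ≡ substT shift (substT σ t)
  lift-shiftT σ t = trans (substT-comp (lift σ) shift t) (sym (substT-comp shift σ t))

  lift-↑ : ∀ σ A → substF (lift σ) (↑ A) ≡ ↑ (substF σ A)
  lift-↑ σ A = trans (substF-comp (lift σ) shift A) (sym (substF-comp shift σ A))

  lift-σS : ∀ σ A → substF (lift σ) (substF σS A) ≡ substF σS (substF (lift σ) A)
  lift-σS σ A =
    trans (substF-fuse (lift σ) σS (σS ∘ₛ lift σ) pointwise A) (sym (substF-comp σS (lift σ) A))
    where
    pointwise : (lift σ ∘ₛ σS) ≗ₛ (σS ∘ₛ lift σ)
    pointwise zero = refl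
    pointwise (suc i) = sym (substT-fuse σS shift shift (λ _ → refl) (σ i))

  inst-lift-shift : ∀ A → (substF (lift shift) A) [ var 0 ] ≡ A
  inst-lift-shift A = trans (substF-fuse (σ₀ (var 0)) (lift shift) var pointwise A) (substF-id A)
    where
    pointwise : (σ₀ (var 0) ∘ₛ lift shift) ≗ₛ var
    pointwise zero = refl
    pointwise (suc i) = refl

module DerivationStructure where
  open SubstitutionAlgebra

  weaken : ∀ {Ax Ok Γ Δ A} → Der Ax Ok Γ A → Γ ⊆ Δ → Der Ax Ok Δ A
  weaken (ax a) s = ax a
  weaken (hyp a) s = hyp (s a)
  weaken (⇒I d) s = ⇒I (weaken d (∷⁺ʳ _ s))
  weaken (⇒E d d₁) s = ⇒E (weaken d s) (weaken d₁ s)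
  weaken (∧I d d₁) s = ∧I (weaken d s) (weaken d₁ s)
  weaken (∧E₁ d) s = ∧E₁ (weaken d s)
  weaken (∧E₂ d) s = ∧E₂ (weaken d s)
  weaken (∨I₁ d) s = ∨I₁ (weaken d s)
  weaken (∨I₂ d) s = ∨I₂ (weaken d s)
  weaken (∨E d d₁ d₂) s = ∨E (weaken d s) (weaken d₁ (∷⁺ʳ _ s)) (weaken d₂ (∷⁺ʳ _ s))
  weaken (⊥E d) s = ⊥E (weaken d s)
  weaken (raa d) s = raa (weaken d (∷⁺ʳ _ s))
  weaken (∀I d) s = ∀I (weaken d (map⁺ ↑ s))
  weaken (∀E t ok d) s = ∀E t ok (weaken d s)
  weaken (∃I t ok d) s = ∃I t ok (weaken d s)
  weaken (∃E d d₁) s = ∃E (weaken d s) (weaken d₁ (∷⁺ʳ _ (map⁺ ↑ s)))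
  weaken =refl s = =refl
  weaken (=E A d d₁) s = =E A (weaken d s) (weaken d₁ s)

  mutual
    AllSym-substT : ∀ {Q σ} → (∀ i → AllSymT Q (σ i)) → ∀ t → AllSymT Q t → AllSymT Q (substT σ t)
    AllSym-substT h (var x) a = h x
    AllSym-substT h (app f ts) (q , a) = q , AllSym-substV h ts a

    AllSym-substV : ∀ {Q σ k} → (∀ i → AllSymT Q (σ i)) → (ts : Vec Term k) → AllSymV Q ts →
                    AllSymV Q (substV σ ts)
    AllSym-substV h [] a = tt
    AllSym-substV h (t ∷ ts) (a , b) = AllSym-substT h t a , AllSym-substV h ts b

  AllSym-lift : ∀ {Q σ} → (∀ i → AllSymT Q (σ i)) → ∀ i → AllSymT Q (lift σ i)
  AllSym-lift h zero = tt
  AllSym-lift h (suc i) = AllSym-substT (λ _ → tt) _ (h i)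

  AllSym-substF : ∀ {Q σ} → (∀ i → AllSymT Q (σ i)) → ∀ A → AllSymF Q A → AllSymF Q (substF σ A)
  AllSym-substF h (t ≐ s) (a , b) = AllSym-substT h t a , AllSym-substT h s b
  AllSym-substF h ⊥' a = tt
  AllSym-substF h (A ⇒ B) (a , b) = AllSym-substF h A a , AllSym-substF h B b
  AllSym-substF h (A ∧' B) (a , b) = AllSym-substF h A a , AllSym-substF h B b
  AllSym-substF h (A ∨' B) (a , b) = AllSym-substF h A a , AllSym-substF h B b
  AllSym-substF h (all' A) a = AllSym-substF (AllSym-lift h) A a
  AllSym-substF h (ex' A) a = AllSym-substF (AllSym-lift h) A a

  mutual
    AllSym-monoT : ∀ {Q Q'} → (∀ {f} → Q f → Q' f) → ∀ t → AllSymT Q t → AllSymT Q' t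
    AllSym-monoT m (var x) a = tt
    AllSym-monoT m (app f ts) (q , a) = m q , AllSym-monoV m ts a

    AllSym-monoV : ∀ {Q Q' k} → (∀ {f} → Q f → Q' f) → (ts : Vec Term k) → AllSymV Q ts → AllSymV Q' ts
    AllSym-monoV m [] a = tt
    AllSym-monoV m (t ∷ ts) (a , b) = AllSym-monoT m t a , AllSym-monoV m ts b

  AllSym-monoF : ∀ {Q Q'} → (∀ {f} → Q f → Q' f) → ∀ A → AllSymF Q A → AllSymF Q' A
  AllSym-monoF m (t ≐ s) (a , b) = AllSym-monoT m t a , AllSym-monoT m s b
  AllSym-monoF m ⊥' a = tt
  AllSym-monoF m (A ⇒ B) (a , b) = AllSym-monoF m A a , AllSym-monoF m B b
  AllSym-monoF m (A ∧' B) (a , b) = AllSym-monoF m A a , AllSym-monoF m B b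
  AllSym-monoF m (A ∨' B) (a , b) = AllSym-monoF m A a , AllSym-monoF m B b
  AllSym-monoF m (all' A) a = AllSym-monoF m A a
  AllSym-monoF m (ex' A) a = AllSym-monoF m A a

  mutual
    substT-local : ∀ {σ τ k} → (∀ i → i < k → σ i ≡ τ i) → ∀ t → maxVarT t ≤ k → substT σ t ≡ substT τ t
    substT-local e (var x) le = e x le
    substT-local e (app f ts) le = cong (app f) (substV-local e ts le)

    substV-local : ∀ {σ τ k m} → (∀ i → i < k → σ i ≡ τ i) → (ts : Vec Term m) → maxVarV ts ≤ k →
                   substV σ ts ≡ substV τ ts
    substV-local e [] le = refl
    substV-local e (t ∷ ts) le =
      cong₂ _∷_ (substT-local e t (m⊔n≤o⇒m≤o (maxVarT t) _ le)) (substV-local e ts (m⊔n≤o⇒n≤o (maxVarT t) _ le))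

  liftN : ℕ → Subst → Subst
  liftN zero σ = σ
  liftN (suc k) σ = lift (liftN k σ)

  substF-all^ : ∀ k σ B → substF σ (all^ k B) ≡ all^ k (substF (liftN k σ) B)
  substF-all^ zero σ B = refl
  substF-all^ (suc k) σ B = cong all' (trans (substF-all^ k (lift σ) B) (cong (all^ k) (substF-ext (lifts k) B)))
    where
    lifts : ∀ k → liftN k (lift σ) ≗ₛ lift (liftN k σ)
    lifts zero i = refl
    lifts (suc k) = lift-ext (lifts k)

  liftN-bound : ∀ k σ i → i < k → liftN k σ i ≡ var i
  liftN-bound (suc k) σ zero le = refl
  liftN-bound (suc k) σ (suc i) (s≤s le) = cong (substT shift) (liftN-bound k σ i le)

  closure-closed : ∀ σ l r → substF σ (all^ (maxVarT l ⊔ maxVarT r) (l ≐ r)) ≡ all^ (maxVarT l ⊔ maxVarT r) (l ≐ r)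
  closure-closed σ l r = trans (substF-all^ k σ (l ≐ r)) (cong (all^ k) (cong₂ _≐_
      (trans (substT-local (liftN-bound k σ) l (m⊔n≤o⇒m≤o (maxVarT l) _ ≤-refl)) (substT-id l))
      (trans (substT-local (liftN-bound k σ) r (m⊔n≤o⇒n≤o (maxVarT l) _ ≤-refl)) (substT-id r))))
    where k = maxVarT l ⊔ maxVarT r

  BasicSubst : Subst → Set
  BasicSubst σ = ∀ i → Basic (σ i)

  map-lift-↑ : ∀ σ Γ → mapL (substF (lift σ)) (mapL ↑ Γ) ≡ mapL ↑ (mapL (substF σ) Γ)
  map-lift-↑ σ [] = refl
  map-lift-↑ σ (A ∷ Γ) = cong₂ _∷_ (lift-↑ σ A) (map-lift-↑ σ Γ)

  basic-inLang : ∀ {P f} → (f ≡ 𝟘) ⊎ (f ≡ 𝕊) → InLang P f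
  basic-inLang (inj₁ e) = inj₁ e
  basic-inLang (inj₂ e) = inj₂ (inj₁ e)

  -- the axioms of 𝐀(P) are closed under basic substitutions: equation axioms
  -- are closed formulas, and a basic instance of an induction axiom is again one
  substAx : ∀ {P Γ} σ → BasicSubst σ → ∀ {A} → AxA P A → Der (AxA P) Basic Γ (substF σ A)
  substAx σ b (eqAx {E} p) = subst (Der _ _ _) (sym (closure-closed σ (lhs E) (rhs E))) (ax (eqAx p))
  substAx σ b sep1 = ax sep1
  substAx σ b sep2 = ax sep2
  substAx σ b (ind {A} lang) = subst (Der _ _ _) instance-eq (ax (ind lang'))
    where
    lang' = AllSym-substF (AllSym-lift (λ i → AllSym-monoT basic-inLang (σ i) (b i))) A lang
    instance-eq : Ind (substF (lift σ) A) ≡ substF σ (Ind A)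
    instance-eq = cong₂ _⇒_ (sym (subst-inst σ zeroT A))
                    (cong₂ _⇒_ (cong all' (cong₂ _⇒_ refl (sym (lift-σS σ A)))) refl)

  substDer : ∀ {P Γ A} σ → BasicSubst σ → Der (AxA P) Basic Γ A →
             Der (AxA P) Basic (mapL (substF σ) Γ) (substF σ A)
  substDer σ b (ax a) = substAx σ b a
  substDer σ b (hyp h) = hyp (∈-map⁺ (substF σ) h)
  substDer σ b (⇒I d) = ⇒I (substDer σ b d)
  substDer σ b (⇒E d d₁) = ⇒E (substDer σ b d) (substDer σ b d₁)
  substDer σ b (∧I d d₁) = ∧I (substDer σ b d) (substDer σ b d₁)
  substDer σ b (∧E₁ d) = ∧E₁ (substDer σ b d)
  substDer σ b (∧E₂ d) = ∧E₂ (substDer σ b d)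
  substDer σ b (∨I₁ d) = ∨I₁ (substDer σ b d)
  substDer σ b (∨I₂ d) = ∨I₂ (substDer σ b d)
  substDer σ b (∨E d d₁ d₂) = ∨E (substDer σ b d) (substDer σ b d₁) (substDer σ b d₂)
  substDer σ b (⊥E d) = ⊥E (substDer σ b d)
  substDer σ b (raa d) = raa (substDer σ b d)
  substDer {Γ = Γ} σ b (∀I d) =
    ∀I (subst (λ Δ → Der _ _ Δ _) (map-lift-↑ σ Γ) (substDer (lift σ) (AllSym-lift b) d))
  substDer σ b (∀E {A = A} t bt d) =
    subst (Der _ _ _) (sym (subst-inst σ t A)) (∀E (substT σ t) (AllSym-substT b t bt) (substDer σ b d))
  substDer σ b (∃I {A = A} t bt d) =
    ∃I (substT σ t) (AllSym-substT b t bt) (subst (Der _ _ _) (subst-inst σ t A) (substDer σ b d))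
  substDer {Γ = Γ} σ b (∃E {A = A} {C = B} d d₁) = ∃E (substDer σ b d)
    (subst (λ Δ → Der _ _ (substF (lift σ) A ∷ Δ) (↑ (substF σ B))) (map-lift-↑ σ Γ)
      (subst (Der _ _ _) (lift-↑ σ B) (substDer (lift σ) (AllSym-lift b) d₁)))
  substDer σ b =refl = =refl
  substDer σ b (=E A {t} {s} d d₁) = subst (Der _ _ _) (sym (subst-inst σ s A))
    (=E (substF (lift σ) A) (subst (Der _ _ _) (subst-inst σ t A) (substDer σ b d)) (substDer σ b d₁))

  shiftDer : ∀ {P Γ A} → Der (AxA P) Basic Γ A → Der (AxA P) Basic (mapL ↑ Γ) (↑ A)
  shiftDer = substDer shift (λ _ → tt)

-- A term t "has a value"
-- when ∃y (t = y) is derivable; a universal statement may be instantiated,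
-- and an existential one introduced, at any term with a value, although only
-- variables are used in the derivation.
module BasicReasoning (P : Equation → Set) where
  open SubstitutionAlgebra
  open DerivationStructure

  infix 4 _⊢ᵇ_ _⊢↓_

  _⊢ᵇ_ : List Form → Form → Set
  Γ ⊢ᵇ A = Der (AxA P) Basic Γ A

  cast : ∀ {Γ A B} → A ≡ B → Γ ⊢ᵇ A → Γ ⊢ᵇ B
  cast = subst (_ ⊢ᵇ_)

  ≐-sym : ∀ {Γ t s} → Γ ⊢ᵇ t ≐ s → Γ ⊢ᵇ s ≐ t
  ≐-sym {t = t} {s} d = cast (cong (s ≐_) (inst-shiftT s t))
    (=E (var 0 ≐ substT shift t) (cast (cong (t ≐_) (sym (inst-shiftT t t))) =refl) d)

  ≐-trans : ∀ {Γ t s u} → Γ ⊢ᵇ t ≐ s → Γ ⊢ᵇ s ≐ u → Γ ⊢ᵇ t ≐ u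
  ≐-trans {t = t} {s} {u} d e = cast (cong (_≐ u) (inst-shiftT u t))
    (=E (substT shift t ≐ var 0) (cast (cong (_≐ s) (sym (inst-shiftT s t))) d) e)

  -- congruence for a context c whose hole is the variable 0
  ≐-cong : ∀ {Γ a b} c → Γ ⊢ᵇ a ≐ b → Γ ⊢ᵇ substT (σ₀ a) c ≐ substT (σ₀ b) c
  ≐-cong {a = a} {b} c d = cast (cong (_≐ substT (σ₀ b) c) (inst-shiftT b ca))
    (=E (substT shift ca ≐ c) (cast (cong (_≐ ca) (sym (inst-shiftT a ca))) =refl) d)
    where ca = substT (σ₀ a) c

  Val : Term → Form
  Val t = ex' (substT shift t ≐ var 0)

  _⊢↓_ : List Form → Term → Set
  Γ ⊢↓ t = Γ ⊢ᵇ Val t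

  Val-subst : ∀ σ t → substF σ (Val t) ≡ Val (substT σ t)
  Val-subst σ t = cong ex' (cong (_≐ var 0) (lift-shiftT σ t))

  ↓-≐ : ∀ {Γ t s} → Γ ⊢ᵇ t ≐ s → Γ ⊢↓ s → Γ ⊢↓ t
  ↓-≐ d e = =E (ex' (var 1 ≐ var 0)) e (≐-sym d)

  ↓-var : ∀ {Γ} i → Γ ⊢↓ var i
  ↓-var i = ∃I (var i) tt =refl

  ↓-zero : ∀ {Γ} → Γ ⊢↓ zeroT
  ↓-zero = ∃I zeroT (inj₁ refl , tt) =refl

  ↓-suc : ∀ {Γ t} → Γ ⊢↓ t → Γ ⊢↓ sucT t
  ↓-suc {t = t} d = ∃E d (cast (sym (Val-subst shift (sucT t)))
    (↓-≐ (≐-cong (sucT (var 0)) (hyp (here refl))) (∃I (sucT (var 0)) (inj₂ refl , tt , tt) =refl)))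

  -- ∀-elimination at a term with a value: eliminate at the variable y with
  -- t = y, then rewrite y back to t
  inst↓ : ∀ {Γ A t} → Γ ⊢ᵇ all' A → Γ ⊢↓ t → Γ ⊢ᵇ A [ t ]
  inst↓ {A = A} {t} d e = ∃E e (cast (sym (subst-inst shift t A))
    (=E (substF (lift shift) A)
      (∀E (var 0) tt (weaken (shiftDer d) (xs⊆x∷xs _ _)))
      (≐-sym (hyp (here refl)))))

  ex↓ : ∀ {Γ A t} → Γ ⊢↓ t → Γ ⊢ᵇ A [ t ] → Γ ⊢ᵇ ex' A
  ex↓ {A = A} {t} e d = ∃E e
    (∃I (var 0) tt (=E (substF (lift shift) A)
      (cast (subst-inst shift t A) (weaken (shiftDer d) (xs⊆x∷xs _ _)))
      (hyp (here refl))))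

  shiftBy : ℕ → Subst
  shiftBy k i = var (k + i)

  -- instantiating the k outermost quantifiers of all^ k B, the outermost by
  -- ρ (k - 1) and the innermost by ρ 0, is the substitution instSubst k ρ
  instSubst : ℕ → Subst → Subst
  instSubst zero ρ = var
  instSubst (suc k) ρ = instSubst k ρ ∘ₛ liftN k (σ₀ (ρ k))

  inst-all^ : ∀ {Γ} k B ρ → (∀ i → Γ ⊢↓ ρ i) → Γ ⊢ᵇ all^ k B → Γ ⊢ᵇ substF (instSubst k ρ) B
  inst-all^ zero B ρ h d = cast (sym (substF-id B)) d
  inst-all^ (suc k) B ρ h d = cast (substF-comp (instSubst k ρ) τ B)
    (inst-all^ k (substF τ B) ρ h (cast (substF-all^ k (σ₀ (ρ k)) B) (inst↓ d (h k))))
    where τ = liftN k (σ₀ (ρ k))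

  liftN-above : ∀ k σ j → liftN k σ (k + j) ≡ substT (shiftBy k) (σ j)
  liftN-above zero σ j = sym (substT-id (σ j))
  liftN-above (suc k) σ j = trans (cong (substT shift) (liftN-above k σ j)) (substT-comp shift (shiftBy k) (σ j))

  instSubst-above : ∀ k ρ j → instSubst k ρ (k + j) ≡ var j
  instSubst-above zero ρ j = refl
  instSubst-above (suc k) ρ j = trans
    (cong (substT (instSubst k ρ)) (trans (cong (liftN k (σ₀ (ρ k))) (sym (+-suc k j))) (liftN-above k _ (suc j))))
    (instSubst-above k ρ j)

  instSubst-below : ∀ k ρ i → i < k → instSubst k ρ i ≡ ρ i
  instSubst-below (suc k) ρ i i<1+k with m<1+n⇒m<n∨m≡n i<1+k
  ... | inj₁ i<k = trans (cong (substT (instSubst k ρ)) (liftN-bound k _ i i<k)) (instSubst-below k ρ i i<k)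
  ... | inj₂ refl = trans
    (cong (substT (instSubst k ρ)) (trans (cong (liftN k _) (sym (+-identityʳ k))) (liftN-above k _ 0)))
    (trans (substT-fuse (instSubst k ρ) (shiftBy k) var (instSubst-above k ρ) (ρ k)) (substT-id (ρ k)))

  instEq : ∀ {Γ E} → P E → ∀ ρ → (∀ i → Γ ⊢↓ ρ i) → Γ ⊢ᵇ substT ρ (lhs E) ≐ substT ρ (rhs E)
  instEq {E = l ≈ r} p ρ h = cast (cong₂ _≐_
      (substT-local (instSubst-below k ρ) l (m⊔n≤o⇒m≤o (maxVarT l) _ ≤-refl))
      (substT-local (instSubst-below k ρ) r (m⊔n≤o⇒n≤o (maxVarT l) _ ≤-refl)))
    (inst-all^ k (l ≐ r) ρ h (ax (eqAx p)))
    where k = maxVarT l ⊔ maxVarT r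

  axEq : ∀ {Γ E} → P E → Γ ⊢ᵇ lhs E ≐ rhs E
  axEq {E = l ≈ r} p = cast (cong₂ _≐_ (substT-id l) (substT-id r)) (instEq p var ↓-var)

  gen^ : ∀ n {B} → [] ⊢ᵇ B → [] ⊢ᵇ all^ n B
  gen^ zero d = d
  gen^ (suc n) d = ∀I (gen^ n d)

  ind↓ : ∀ u → AllSymT (InLang P) u → [] ⊢↓ substT (σ₀ zeroT) u → Val u ∷ [] ⊢↓ substT σS u → [] ⊢ᵇ all' (Val u)
  ind↓ u inLang base step = ⇒E (⇒E (ax (ind (AllSym-substT (λ _ → tt) u inLang , tt)))
                                   (cast (sym (Val-subst (σ₀ zeroT) u)) base))
                               (∀I (⇒I (cast (sym (Val-subst σS u)) step)))

  all^-map : ∀ {A B} → (∀ {Δ} → Δ ⊢ᵇ A → Δ ⊢ᵇ B) → ∀ n {Γ} → Γ ⊢ᵇ all^ n A → Γ ⊢ᵇ all^ n B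
  all^-map h zero d = h d
  all^-map {A} h (suc n) d = ∀I (all^-map h n (cast (inst-lift-shift (all^ n A)) (∀E (var 0) tt (shiftDer d))))

-- The proof is by
-- induction on c; the recursion case applies the induction axiom of 𝐀(P) to
-- the formula ∃y R(x, x⃗) = y.
module PRTotality (P : Equation → Set) (hasPR : ∀ {n} (c : PR n) {E} → DefEq c E → P E) where
  open SubstitutionAlgebra
  open DerivationStructure
  open BasicReasoning P

  substV-tab : ∀ {k} σ (h : Fin k → ℕ) → substV σ (tabulate (λ i → var (h i))) ≡ tabulate (λ i → σ (h i))
  substV-tab {zero} σ h = refl
  substV-tab {suc k} σ h = cong (σ (h fzero) ∷_) (substV-tab σ (λ i → h (fsuc i)))

  AllSym-tabVars : ∀ {Q k} (h : Fin k → ℕ) → AllSymV Q (tabulate (λ i → var (h i)))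
  AllSym-tabVars {k = zero} h = tt
  AllSym-tabVars {k = suc k} h = tt , AllSym-tabVars (λ i → h (fsuc i))

  vars↓ : ∀ {Γ k} (h : Fin k → ℕ) → All (Γ ⊢↓_) (tabulate (λ i → var (h i)))
  vars↓ h = tabulate⁺ (λ i → ↓-var (h i))

  vecEnv : ∀ {k} → Vec Term k → Subst
  vecEnv [] i = var i
  vecEnv (t ∷ ts) zero = t
  vecEnv (t ∷ ts) (suc i) = vecEnv ts i

  vecEnv-vars : ∀ {k} (ts : Vec Term k) → substV (vecEnv ts) (vars k) ≡ ts
  vecEnv-vars ts = trans (substV-tab (vecEnv ts) toℕ) (entries ts)
    where
    entries : ∀ {k} (ts : Vec Term k) → tabulate (λ i → vecEnv ts (toℕ i)) ≡ ts
    entries [] = refl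
    entries (t ∷ ts) = cong (t ∷_) (entries ts)

  vecEnv-∷ʳ-vars : ∀ {k} (ts : Vec Term k) u → substV (vecEnv (ts ∷ʳ u)) (vars k) ≡ ts
  vecEnv-∷ʳ-vars ts u = trans (substV-tab (vecEnv (ts ∷ʳ u)) toℕ) (entries ts)
    where
    entries : ∀ {k} (ts : Vec Term k) → tabulate (λ i → vecEnv (ts ∷ʳ u) (toℕ i)) ≡ ts
    entries [] = refl
    entries (t ∷ ts) = cong (t ∷_) (entries ts)

  vecEnv-∷ʳ-last : ∀ {k} (ts : Vec Term k) u → vecEnv (ts ∷ʳ u) k ≡ u
  vecEnv-∷ʳ-last [] u = refl
  vecEnv-∷ʳ-last (t ∷ ts) u = vecEnv-∷ʳ-last ts u

  vecEnv-↓ : ∀ {Γ k} {ts : Vec Term k} → All (Γ ⊢↓_) ts → ∀ i → Γ ⊢↓ vecEnv ts i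
  vecEnv-↓ [] i = ↓-var i
  vecEnv-↓ (t↓ ∷ ts↓) zero = t↓
  vecEnv-↓ (t↓ ∷ ts↓) (suc i) = vecEnv-↓ ts↓ i

  All-∷ʳ : ∀ {Q : Term → Set} {k} {ts : Vec Term k} {u} → All Q ts → Q u → All Q (ts ∷ʳ u)
  All-∷ʳ [] qu = qu ∷ []
  All-∷ʳ (qt ∷ qts) qu = qt ∷ All-∷ʳ qts qu

  ProvablyTotal : ∀ {n} → PR n → Set
  ProvablyTotal {n} c = [] ⊢ᵇ all^ n (Val (app (prf c) (vars n)))

  app↓ : ∀ {n Γ} {c : PR n} {ts : Vec Term n} → ProvablyTotal c → All (Γ ⊢↓_) ts → Γ ⊢↓ app (prf c) ts
  app↓ {n} {c = c} {ts} tot ts↓ =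
    cast (trans (Val-subst (instSubst n ρ) (app (prf c) (vars n))) (cong (λ v → Val (app (prf c) v)) args))
         (inst-all^ n _ ρ (vecEnv-↓ ts↓) (weaken tot (λ ())))
    where
    ρ = vecEnv ts
    args : substV (instSubst n ρ) (vars n) ≡ ts
    args = trans (substV-tab (instSubst n ρ) toℕ)
      (trans (tabulate-cong (λ i → instSubst-below n ρ (toℕ i) (toℕ<n i)))
             (trans (sym (substV-tab ρ toℕ)) (vecEnv-vars ts)))

  total-Z : ProvablyTotal Z
  total-Z = ↓-≐ (axEq (hasPR Z dZ)) ↓-zero

  total-S : ProvablyTotal Sc
  total-S = ∀I (↓-≐ (axEq (hasPR Sc dS)) (↓-suc (↓-var 0)))

  total-P : ∀ {n} (i : Fin n) → ProvablyTotal (Pj i)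
  total-P {n} i = gen^ n (↓-≐ (axEq (hasPR (Pj i) (dP i)))
    (subst ([] ⊢↓_) (sym (lookup∘tabulate (λ j → var (toℕ j)) i)) (↓-var (toℕ i))))

  total-C : ∀ {k n} {g : PR k} {hs : Vec (PR n) k} → ProvablyTotal g → All ProvablyTotal hs →
            ProvablyTotal (C g hs)
  total-C {n = n} {g} {hs} g-tot hs-tot = gen^ n (↓-≐ (axEq (hasPR (C g hs) (dC g hs))) (app↓ g-tot (args↓ hs-tot)))
    where
    args↓ : ∀ {k} {hs : Vec (PR n) k} → All ProvablyTotal hs → All ([] ⊢↓_) (map (λ h → app (prf h) (vars n)) hs)
    args↓ [] = []
    args↓ (h-tot ∷ hs-tot) = app↓ h-tot (vars↓ toℕ) ∷ args↓ hs-tot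

  all^-suc : ∀ n B → all^ n (all' B) ≡ all^ (suc n) B
  all^-suc zero B = refl
  all^-suc (suc n) B = cong all' (all^-suc n B)

  -- induction on the first argument of R g h, inside the n parameter quantifiers:
  -- with x = var 1, y = var 0 and R(x, p⃗) = y, the defining equation gives
  -- R(S x, p⃗) = h(x, R(x, p⃗), p⃗) = h(x, y, p⃗), which has a value
  total-R : ∀ {n} {g : PR n} {h : PR (suc (suc n))} → ProvablyTotal g → ProvablyTotal h → ProvablyTotal (R g h)
  total-R {n} {g} {h} g-tot h-tot = cast (all^-suc n _) (gen^ n (ind↓ (app RS (var 0 ∷ ps₁)) inLang base step))
    where
    RS = prf (R g h)
    -- the parameters p⃗ as seen under one and under two further binders
    ps₁ ps₂ : Vec Term n
    ps₁ = tabulate (λ i → var (suc (toℕ i)))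
    ps₂ = tabulate (λ i → var (suc (suc (toℕ i))))
    inLang : AllSymT (InLang P) (app RS (var 0 ∷ ps₁))
    inLang = inj₂ (inj₂ (_ , hasPR (R g h) (dR0 g h) , inj₁ (inj₁ refl))) , tt , AllSym-tabVars (λ i → suc (toℕ i))
    base : [] ⊢↓ substT (σ₀ zeroT) (app RS (var 0 ∷ ps₁))
    base = subst (λ v → [] ⊢↓ app RS (zeroT ∷ v)) (sym (substV-tab (σ₀ zeroT) (λ i → suc (toℕ i))))
      (↓-≐ (axEq (hasPR (R g h) (dR0 g h))) (app↓ g-tot (vars↓ toℕ)))
    shifted-ps : substV shift ps₁ ≡ ps₂
    shifted-ps = substV-tab shift (λ i → suc (toℕ i))
    -- hypotheses after eliminating the induction hypothesis ∃y R(x, p⃗) = y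
    Δ : List Form
    Δ = (app RS (var 1 ∷ substV shift ps₁) ≐ var 0) ∷ ↑ (Val (app RS (var 0 ∷ ps₁))) ∷ []
    recursion-eq : Δ ⊢ᵇ app RS (sucT (var 1) ∷ ps₂) ≐ app (prf h) (var 1 ∷ app RS (var 1 ∷ ps₂) ∷ ps₂)
    recursion-eq = cast (cong₂ (λ x v → app RS (sucT x ∷ v) ≐ app (prf h) (x ∷ app RS (x ∷ v) ∷ v))
                               (vecEnv-∷ʳ-last ps₂ (var 1)) (vecEnv-∷ʳ-vars ps₂ (var 1)))
      (instEq (hasPR (R g h) (dR1 g h)) (vecEnv (ps₂ ∷ʳ var 1))
        (vecEnv-↓ {ts = ps₂ ∷ʳ var 1} (All-∷ʳ (vars↓ (λ i → suc (suc (toℕ i)))) (↓-var 1))))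
    hypothesis-eq : Δ ⊢ᵇ app (prf h) (var 1 ∷ app RS (var 1 ∷ ps₂) ∷ ps₂) ≐ app (prf h) (var 1 ∷ var 0 ∷ ps₂)
    hypothesis-eq =
      cast (cong₂ (λ v w → app (prf h) (var 1 ∷ app RS (var 1 ∷ ps₂) ∷ v) ≐ app (prf h) (var 1 ∷ var 0 ∷ w))
                  (inst-shiftV _ ps₂) (inst-shiftV _ ps₂))
        (≐-cong (app (prf h) (var 2 ∷ var 0 ∷ substV shift ps₂))
          (subst (λ v → Δ ⊢ᵇ app RS (var 1 ∷ v) ≐ var 0) shifted-ps (hyp (here refl))))
    successor : Δ ⊢↓ app RS (sucT (var 1) ∷ ps₂)
    successor = ↓-≐ (≐-trans recursion-eq hypothesis-eq)
      (app↓ h-tot (↓-var 1 ∷ ↓-var 0 ∷ vars↓ (λ i → suc (suc (toℕ i)))))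
    step : Val (app RS (var 0 ∷ ps₁)) ∷ [] ⊢↓ substT σS (app RS (var 0 ∷ ps₁))
    step = subst (λ v → Val (app RS (var 0 ∷ ps₁)) ∷ [] ⊢↓ app RS (sucT (var 0) ∷ v))
                 (sym (substV-tab σS (λ i → suc (toℕ i))))
      (∃E (hyp (here refl)) (cast (sym (trans (Val-subst shift (app RS (sucT (var 0) ∷ ps₁)))
                                              (cong (λ v → Val (app RS (sucT (var 1) ∷ v))) shifted-ps)))
                                 successor))

  mutual
    prf-total : ∀ {n} (c : PR n) → ProvablyTotal c
    prf-total Z = total-Z
    prf-total Sc = total-S
    prf-total (Pj i) = total-P i
    prf-total (C g hs) = total-C (prf-total g) (prf-totals hs)
    prf-total (R g h) = total-R (prf-total g) (prf-total h)

    prf-totals : ∀ {k n} (hs : Vec (PR n) k) → All ProvablyTotal hs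
    prf-totals [] = []
    prf-totals (h ∷ hs) = prf-total h ∷ prf-totals hs

-- The only symbols of 𝐀(PR) are 0, S and
-- PR symbols, so every term used in a ∀-elimination or ∃-introduction has a
-- value in 𝐀(P); those steps are replaced by inst↓ and ex↓, which use
-- variables only.
module Translation (P : Equation → Set) (hasPR : ∀ {n} (c : PR n) {E} → DefEq c E → P E) where
  open DerivationStructure
  open BasicReasoning P
  open PRTotality P hasPR

  PRSym : Sym → Set
  PRSym f = (f ≡ 𝟘) ⊎ (f ≡ 𝕊) ⊎ Σ ℕ (λ n → Σ (PR n) (λ c → f ≡ prf c))

  mutual
    term↓ : ∀ {Γ} t → AllSymT PRSym t → Γ ⊢↓ t
    term↓ (var x) _ = ↓-var x
    term↓ (app .𝟘 []) (inj₁ refl , _) = ↓-zero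
    term↓ (app .𝕊 (t ∷ [])) (inj₂ (inj₁ refl) , a , tt) = ↓-suc {t = t} (term↓ t a)
    term↓ (app .(prf c) ts) (inj₂ (inj₂ (n , c , refl)) , a) = app↓ (prf-total c) (terms↓ ts a)

    terms↓ : ∀ {Γ k} (ts : Vec Term k) → AllSymV PRSym ts → All (Γ ⊢↓_) ts
    terms↓ [] tt = []
    terms↓ (t ∷ ts) (a , b) = term↓ t a ∷ terms↓ ts b

  mutual
    occurs-AllSymT : ∀ {Q f} t → AllSymT Q t → OccT f t → Q f
    occurs-AllSymT (app g ts) (q , a) (inj₁ refl) = q
    occurs-AllSymT (app g ts) (q , a) (inj₂ o) = occurs-AllSymV ts a o

    occurs-AllSymV : ∀ {Q f k} (ts : Vec Term k) → AllSymV Q ts → OccV f ts → Q f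
    occurs-AllSymV (t ∷ ts) (a , b) (inj₁ o) = occurs-AllSymT t a o
    occurs-AllSymV (t ∷ ts) (a , b) (inj₂ o) = occurs-AllSymV ts b o

  prSym : ∀ {n} (c : PR n) → PRSym (prf c)
  prSym c = inj₂ (inj₂ (_ , c , refl))

  defEq-PRSym : ∀ {n} {c : PR n} {E} → DefEq c E → AllSymT PRSym (lhs E) × AllSymT PRSym (rhs E)
  defEq-PRSym dZ = (prSym Z , tt) , (inj₁ refl , tt)
  defEq-PRSym dS = (prSym Sc , tt , tt) , (inj₂ (inj₁ refl) , tt , tt)
  defEq-PRSym (dP i) = (prSym (Pj i) , AllSym-tabVars toℕ) ,
    subst (AllSymT PRSym) (sym (lookup∘tabulate (λ j → var (toℕ j)) i)) tt
  defEq-PRSym {n} (dC g hs) = (prSym (C g hs) , AllSym-tabVars toℕ) , (prSym g , components hs)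
    where
    components : ∀ {k} (hs : Vec (PR n) k) → AllSymV PRSym (map (λ h → app (prf h) (vars n)) hs)
    components [] = tt
    components (h ∷ hs) = (prSym h , AllSym-tabVars toℕ) , components hs
  defEq-PRSym (dR0 g h) = (prSym (R g h) , (inj₁ refl , tt) , AllSym-tabVars toℕ) , (prSym g , AllSym-tabVars toℕ)
  defEq-PRSym (dR1 g h) = (prSym (R g h) , (inj₂ (inj₁ refl) , tt , tt) , AllSym-tabVars toℕ) ,
    (prSym h , tt , (prSym (R g h) , tt , AllSym-tabVars toℕ) , AllSym-tabVars toℕ)

  inLang-PRSym : ∀ {f} → InLang PReqs f → PRSym f
  inLang-PRSym (inj₁ e) = inj₁ e
  inLang-PRSym (inj₂ (inj₁ e)) = inj₂ (inj₁ e)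
  inLang-PRSym (inj₂ (inj₂ (E , (n , c , d) , inj₁ o))) = occurs-AllSymT (lhs E) (proj₁ (defEq-PRSym d)) o
  inLang-PRSym (inj₂ (inj₂ (E , (n , c , d) , inj₂ o))) = occurs-AllSymT (rhs E) (proj₂ (defEq-PRSym d)) o

  inLang-mono : ∀ {f} → InLang PReqs f → InLang P f
  inLang-mono (inj₁ e) = inj₁ e
  inLang-mono (inj₂ (inj₁ e)) = inj₂ (inj₁ e)
  inLang-mono (inj₂ (inj₂ (E , (n , c , d) , o))) = inj₂ (inj₂ (E , hasPR c d , o))

  translate : ∀ {Γ A} → Der (AxA PReqs) (AllSymT (InLang PReqs)) Γ A → Γ ⊢ᵇ A
  translate (ax (eqAx (n , c , d))) = ax (eqAx (hasPR c d))
  translate (ax sep1) = ax sep1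
  translate (ax sep2) = ax sep2
  translate (ax (ind {A} lang)) = ax (ind (AllSym-monoF inLang-mono A lang))
  translate (hyp h) = hyp h
  translate (⇒I d) = ⇒I (translate d)
  translate (⇒E d d₁) = ⇒E (translate d) (translate d₁)
  translate (∧I d d₁) = ∧I (translate d) (translate d₁)
  translate (∧E₁ d) = ∧E₁ (translate d)
  translate (∧E₂ d) = ∧E₂ (translate d)
  translate (∨I₁ d) = ∨I₁ (translate d)
  translate (∨I₂ d) = ∨I₂ (translate d)
  translate (∨E d d₁ d₂) = ∨E (translate d) (translate d₁) (translate d₂)
  translate (⊥E d) = ⊥E (translate d)
  translate (raa d) = raa (translate d)
  translate (∀I d) = ∀I (translate d)
  translate (∀E t lang d) = inst↓ (translate d) (term↓ t (AllSym-monoT inLang-PRSym t lang))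
  translate (∃I t lang d) = ex↓ (term↓ t (AllSym-monoT inLang-PRSym t lang)) (translate d)
  translate (∃E d d₁) = ∃E (translate d) (translate d₁)
  translate =refl = =refl
  translate (=E A d d₁) = =E A (translate d) (translate d₁)

-- The
-- connectives ∨ and ∃ are read double-negated; since atomic formulas (equations
-- between numbers) are decidable, every formula is then stable under double
-- negation and the classical rules are sound.
module Semantics (I : (s : Sym) → Vec ℕ (arity s) → ℕ) where
  open SubstitutionAlgebra

  Env : Set
  Env = ℕ → ℕ

  _∷ₑ_ : ℕ → Env → Env
  (d ∷ₑ ρ) zero = d
  (d ∷ₑ ρ) (suc i) = ρ i

  mutual
    ⟦_⟧ : Term → Env → ℕ
    ⟦ var x ⟧ ρ = ρ x
    ⟦ app f ts ⟧ ρ = I f (⟦ ts ⟧V ρ)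

    ⟦_⟧V : ∀ {k} → Vec Term k → Env → Vec ℕ k
    ⟦ [] ⟧V ρ = []
    ⟦ t ∷ ts ⟧V ρ = ⟦ t ⟧ ρ ∷ ⟦ ts ⟧V ρ

  ¬¬_ : Set → Set
  ¬¬ A = ¬ ¬ A

  ⟦_⟧F : Form → Env → Set
  ⟦ t ≐ s ⟧F ρ = ⟦ t ⟧ ρ ≡ ⟦ s ⟧ ρ
  ⟦ ⊥' ⟧F ρ = ⊥
  ⟦ A ⇒ B ⟧F ρ = ⟦ A ⟧F ρ → ⟦ B ⟧F ρ
  ⟦ A ∧' B ⟧F ρ = ⟦ A ⟧F ρ × ⟦ B ⟧F ρ
  ⟦ A ∨' B ⟧F ρ = ¬¬ (⟦ A ⟧F ρ ⊎ ⟦ B ⟧F ρ)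
  ⟦ all' A ⟧F ρ = ∀ d → ⟦ A ⟧F (d ∷ₑ ρ)
  ⟦ ex' A ⟧F ρ = ¬¬ (Σ ℕ (λ d → ⟦ A ⟧F (d ∷ₑ ρ)))

  stable : ∀ A ρ → ¬¬ (⟦ A ⟧F ρ) → ⟦ A ⟧F ρ
  stable (t ≐ s) ρ nn with ⟦ t ⟧ ρ ≟ ⟦ s ⟧ ρ
  ... | yes p = p
  ... | no ¬p = ⊥-elim (nn ¬p)
  stable ⊥' ρ nn = nn (λ z → z)
  stable (A ⇒ B) ρ nn a = stable B ρ (λ nb → nn (λ f → nb (f a)))
  stable (A ∧' B) ρ nn = stable A ρ (λ na → nn (λ p → na (proj₁ p))) , stable B ρ (λ nb → nn (λ p → nb (proj₂ p)))
  stable (A ∨' B) ρ nn k = nn (λ z → z k)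
  stable (all' A) ρ nn d = stable A (d ∷ₑ ρ) (λ na → nn (λ f → na (f d)))
  stable (ex' A) ρ nn k = nn (λ z → z k)

  mutual
    semT-subst : ∀ σ ρ ρ' → (∀ i → ⟦ σ i ⟧ ρ ≡ ρ' i) → ∀ t → ⟦ substT σ t ⟧ ρ ≡ ⟦ t ⟧ ρ'
    semT-subst σ ρ ρ' e (var x) = e x
    semT-subst σ ρ ρ' e (app f ts) = cong (I f) (semV-subst σ ρ ρ' e ts)

    semV-subst : ∀ {k} σ ρ ρ' → (∀ i → ⟦ σ i ⟧ ρ ≡ ρ' i) → (ts : Vec Term k) → ⟦ substV σ ts ⟧V ρ ≡ ⟦ ts ⟧V ρ'
    semV-subst σ ρ ρ' e [] = refl
    semV-subst σ ρ ρ' e (t ∷ ts) = cong₂ _∷_ (semT-subst σ ρ ρ' e t) (semV-subst σ ρ ρ' e ts)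

  semT-ext : ∀ ρ ρ' → (∀ i → ρ i ≡ ρ' i) → ∀ t → ⟦ t ⟧ ρ ≡ ⟦ t ⟧ ρ'
  semT-ext ρ ρ' e t = trans (cong (λ u → ⟦ u ⟧ ρ) (sym (substT-id t))) (semT-subst var ρ ρ' e t)

  sem-lift : ∀ σ ρ ρ' → (∀ i → ⟦ σ i ⟧ ρ ≡ ρ' i) → ∀ d i → ⟦ lift σ i ⟧ (d ∷ₑ ρ) ≡ (d ∷ₑ ρ') i
  sem-lift σ ρ ρ' e d zero = refl
  sem-lift σ ρ ρ' e d (suc i) = trans (semT-subst shift (d ∷ₑ ρ) ρ (λ _ → refl) (σ i)) (e i)

  semF-subst : ∀ A σ ρ ρ' → (∀ i → ⟦ σ i ⟧ ρ ≡ ρ' i) → ⟦ substF σ A ⟧F ρ ⇔ ⟦ A ⟧F ρ'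
  semF-subst (t ≐ s) σ ρ ρ' e = mk⇔
    (λ p → trans (sym (semT-subst σ ρ ρ' e t)) (trans p (semT-subst σ ρ ρ' e s)))
    (λ p → trans (semT-subst σ ρ ρ' e t) (trans p (sym (semT-subst σ ρ ρ' e s))))
  semF-subst ⊥' σ ρ ρ' e = mk⇔ (λ z → z) (λ z → z)
  semF-subst (A ⇒ B) σ ρ ρ' e = mk⇔ (λ f a → to IB (f (from IA a))) (λ f a → from IB (f (to IA a)))
    where IA = semF-subst A σ ρ ρ' e; IB = semF-subst B σ ρ ρ' e
  semF-subst (A ∧' B) σ ρ ρ' e = mk⇔ (λ (a , b) → to IA a , to IB b) (λ (a , b) → from IA a , from IB b)
    where IA = semF-subst A σ ρ ρ' e; IB = semF-subst B σ ρ ρ' e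
  semF-subst (A ∨' B) σ ρ ρ' e = mk⇔
    (λ nn k → nn (λ { (inj₁ a) → k (inj₁ (to IA a)) ; (inj₂ b) → k (inj₂ (to IB b)) }))
    (λ nn k → nn (λ { (inj₁ a) → k (inj₁ (from IA a)) ; (inj₂ b) → k (inj₂ (from IB b)) }))
    where IA = semF-subst A σ ρ ρ' e; IB = semF-subst B σ ρ ρ' e
  semF-subst (all' A) σ ρ ρ' e = mk⇔ (λ f d → to (IA d) (f d)) (λ f d → from (IA d) (f d))
    where IA = λ d → semF-subst A (lift σ) (d ∷ₑ ρ) (d ∷ₑ ρ') (sem-lift σ ρ ρ' e d)
  semF-subst (ex' A) σ ρ ρ' e = mk⇔
    (λ nn k → nn (λ (d , a) → k (d , to (IA d) a)))
    (λ nn k → nn (λ (d , a) → k (d , from (IA d) a)))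
    where IA = λ d → semF-subst A (lift σ) (d ∷ₑ ρ) (d ∷ₑ ρ') (sem-lift σ ρ ρ' e d)

  semF-ext : ∀ A ρ ρ' → (∀ i → ρ i ≡ ρ' i) → ⟦ A ⟧F ρ → ⟦ A ⟧F ρ'
  semF-ext A ρ ρ' e a = to (semF-subst A var ρ ρ' e) (subst (λ B → ⟦ B ⟧F ρ) (sym (substF-id A)) a)

  sem-inst : ∀ A t ρ → ⟦ A [ t ] ⟧F ρ ⇔ ⟦ A ⟧F (⟦ t ⟧ ρ ∷ₑ ρ)
  sem-inst A t ρ = semF-subst A (σ₀ t) ρ _ (λ { zero → refl ; (suc i) → refl })

  sem-↑ : ∀ A d ρ → ⟦ ↑ A ⟧F (d ∷ₑ ρ) ⇔ ⟦ A ⟧F ρ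
  sem-↑ A d ρ = semF-subst A shift (d ∷ₑ ρ) ρ (λ _ → refl)

  module Soundness (P : Equation → Set)
                   (P-true : ∀ {E} → P E → ∀ ρ → ⟦ lhs E ⟧ ρ ≡ ⟦ rhs E ⟧ ρ)
                   (I-zero : I 𝟘 [] ≡ 0) (I-suc : ∀ x → I 𝕊 (x ∷ []) ≡ suc x) where

    axiom-true : ∀ {A} → AxA P A → ∀ ρ → ⟦ A ⟧F ρ
    axiom-true (eqAx {l ≈ r} p) = closure (maxVarT l ⊔ maxVarT r)
      where
      closure : ∀ k ρ → ⟦ all^ k (l ≐ r) ⟧F ρ
      closure zero ρ = P-true p ρ
      closure (suc k) ρ d = closure k (d ∷ₑ ρ)
    axiom-true sep1 ρ d p with trans (sym (I-suc d)) (trans p I-zero)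
    ... | ()
    axiom-true sep2 ρ d d' p = suc-injective (trans (sym (I-suc d)) (trans p (I-suc d')))
    axiom-true (ind {A} _) ρ base step = induction
      where
      induction : ∀ d → ⟦ A ⟧F (d ∷ₑ ρ)
      induction zero = to (semF-subst A (σ₀ zeroT) ρ (0 ∷ₑ ρ) λ { zero → I-zero ; (suc i) → refl }) base
      induction (suc d) = to (semF-subst A σS (d ∷ₑ ρ) (suc d ∷ₑ ρ) λ { zero → I-suc d ; (suc i) → refl })
                             (step d (induction d))

    Holds : List Form → Env → Set
    Holds Γ ρ = ∀ {B} → B ∈ Γ → ⟦ B ⟧F ρ

    holds-∷ : ∀ {Γ A ρ} → ⟦ A ⟧F ρ → Holds Γ ρ → Holds (A ∷ Γ) ρ
    holds-∷ a g (here refl) = a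
    holds-∷ a g (there p) = g p

    holds-↑ : ∀ {Γ ρ} d → Holds Γ ρ → Holds (mapL ↑ Γ) (d ∷ₑ ρ)
    holds-↑ {A ∷ Γ} d g (here refl) = from (sem-↑ A d _) (g (here refl))
    holds-↑ {A ∷ Γ} d g (there p) = holds-↑ {Γ} d (λ q → g (there q)) p

    sound : ∀ {Ok Γ A} → Der (AxA P) Ok Γ A → ∀ ρ → Holds Γ ρ → ⟦ A ⟧F ρ
    sound (ax a) ρ g = axiom-true a ρ
    sound (hyp h) ρ g = g h
    sound (⇒I d) ρ g a = sound d ρ (holds-∷ a g)
    sound (⇒E d d₁) ρ g = sound d ρ g (sound d₁ ρ g)
    sound (∧I d d₁) ρ g = sound d ρ g , sound d₁ ρ g
    sound (∧E₁ d) ρ g = proj₁ (sound d ρ g)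
    sound (∧E₂ d) ρ g = proj₂ (sound d ρ g)
    sound (∨I₁ d) ρ g k = k (inj₁ (sound d ρ g))
    sound (∨I₂ d) ρ g k = k (inj₂ (sound d ρ g))
    sound (∨E {C = B} d d₁ d₂) ρ g = stable B ρ (λ k → sound d ρ g
      (λ { (inj₁ a) → k (sound d₁ ρ (holds-∷ a g)) ; (inj₂ b) → k (sound d₂ ρ (holds-∷ b g)) }))
    sound (⊥E d) ρ g = ⊥-elim (sound d ρ g)
    sound (raa {A = A} d) ρ g = stable A ρ (λ na → sound d ρ (holds-∷ na g))
    sound (∀I d) ρ g x = sound d (x ∷ₑ ρ) (holds-↑ x g)
    sound (∀E {A = A} t _ d) ρ g = from (sem-inst A t ρ) (sound d ρ g (⟦ t ⟧ ρ))
    sound (∃I {A = A} t _ d) ρ g k = k (⟦ t ⟧ ρ , to (sem-inst A t ρ) (sound d ρ g))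
    sound (∃E {C = B} d d₁) ρ g = stable B ρ (λ k → sound d ρ g
      (λ (x , a) → k (to (sem-↑ B x ρ) (sound d₁ (x ∷ₑ ρ) (holds-∷ a (holds-↑ x g))))))
    sound =refl ρ g = refl
    sound (=E A {t} {s} d d₁) ρ g = from (sem-inst A s ρ)
      (semF-ext A _ _ (λ { zero → sound d₁ ρ g ; (suc i) → refl }) (to (sem-inst A t ρ) (sound d ρ g)))

    consistent : ∀ {Ok} → ¬ (Der (AxA P) Ok [] ⊥')
    consistent d = sound d (λ _ → 0) (λ ())

    sem-≔ : ∀ s x t ρ → ⟦ s [ x ≔ t ] ⟧ ρ ≡ ⟦ s ⟧ (λ y → ⟦ if y ≡ᵇ x then t else var y ⟧ ρ)
    sem-≔ s x t ρ = semT-subst _ ρ _ (λ _ → refl) s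

    eq-sound : ∀ {E} → P ⊢₌ E → ∀ ρ → ⟦ lhs E ⟧ ρ ≡ ⟦ rhs E ⟧ ρ
    eq-sound (mem p) ρ = P-true p ρ
    eq-sound refl₌ ρ = refl
    eq-sound (sub {s} {r} x t d) ρ = trans (sem-≔ s x t ρ) (trans (eq-sound d _) (sym (sem-≔ r x t ρ)))
    eq-sound (rep s r x {t} {t'} d d₁) ρ =
      trans (sem-≔ s x t' ρ) (trans (sym (semT-ext _ _ same s)) (trans (sym (sem-≔ s x t ρ))
        (trans (eq-sound d ρ) (trans (sem-≔ r x t ρ) (trans (semT-ext _ _ same r) (sym (sem-≔ r x t' ρ)))))))
      where
      same : ∀ y → ⟦ if y ≡ᵇ x then t else var y ⟧ ρ ≡ ⟦ if y ≡ᵇ x then t' else var y ⟧ ρ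
      same y with y ≡ᵇ x
      ... | true = eq-sound d₁ ρ
      ... | false = refl

-- Evaluation of PR codes that unfolds compositions and projections but keeps
-- every recursion node opaque.  It agrees with eval, and lets the type checker
-- compare evaluations of large codes (such as Kleene's T) without running the
-- recursions inside them.
module Evaluation where

  opaque
    evalRec : ∀ {m} → PR m → Vec ℕ m → ℕ
    evalRec = eval

  mutual
    ev : ∀ {m} → PR m → Vec ℕ m → ℕ
    ev Z env = 0
    ev Sc (x ∷ []) = suc x
    ev (Pj i) env = lookup env i
    ev (C g hs) env = ev g (evs hs env)
    ev (R g h) env = evalRec (R g h) env

    evs : ∀ {m k} → Vec (PR m) k → Vec ℕ m → Vec ℕ k
    evs [] env = []
    evs (h ∷ hs) env = ev h env ∷ evs hs env

  opaque
    unfolding evalRec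

    mutual
      ev≡eval : ∀ {m} (p : PR m) env → ev p env ≡ eval p env
      ev≡eval Z env = refl
      ev≡eval Sc (x ∷ []) = refl
      ev≡eval (Pj i) env = refl
      ev≡eval (C g hs) env = trans (ev≡eval g (evs hs env)) (cong (eval g) (evs≡evalV hs env))
      ev≡eval (R g h) env = refl

      evs≡evalV : ∀ {m k} (hs : Vec (PR m) k) env → evs hs env ≡ evalV hs env
      evs≡evalV [] env = refl
      evs≡evalV (h ∷ hs) env = cong₂ _∷_ (ev≡eval h env) (evs≡evalV hs env)

  ev-R-zero : ∀ {m} (g : PR m) h xs → ev (R g h) (zero ∷ xs) ≡ ev g xs
  ev-R-zero g h xs = trans (ev≡eval (R g h) (zero ∷ xs)) (sym (ev≡eval g xs))

  ev-R-suc : ∀ {m} (g : PR m) h y xs → ev (R g h) (suc y ∷ xs) ≡ ev h (y ∷ ev (R g h) (y ∷ xs) ∷ xs)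
  ev-R-suc g h y xs = trans (ev≡eval (R g h) (suc y ∷ xs))
    (trans (cong (λ r → eval h (y ∷ r ∷ xs)) (sym (ev≡eval (R g h) (y ∷ xs))))
           (sym (ev≡eval h (y ∷ ev (R g h) (y ∷ xs) ∷ xs))))

module Runs {A : Set} (Halted : A → Set) (step : A → A) where

  record HaltingRun (c : ℕ → A) (L : ℕ) : Set where
    field
      moves : ∀ i → i < L → ¬ Halted (c i) × c (suc i) ≡ step (c i)
      halts : Halted (c L)
  open HaltingRun

  runs-agree : ∀ {c c' L L'} → c 0 ≡ c' 0 → HaltingRun c L → HaltingRun c' L' → c L ≡ c' L'
  runs-agree {c} {c'} {L} {L'} start r r' =
    trans (prefix L ≤-refl (subst (L ≤_) same-length ≤-refl)) (cong c' same-length)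
    where
    prefix : ∀ i → i ≤ L → i ≤ L' → c i ≡ c' i
    prefix zero _ _ = start
    prefix (suc i) i<L i<L' = trans (proj₂ (moves r i i<L))
      (trans (cong step (prefix i (<⇒≤ i<L) (<⇒≤ i<L'))) (sym (proj₂ (moves r' i i<L'))))
    same-length : L ≡ L'
    same-length with <-cmp L L'
    ... | tri< L<L' _ _ =
      ⊥-elim (proj₁ (moves r' L L<L') (subst Halted (prefix L ≤-refl (<⇒≤ L<L')) (halts r)))
    ... | tri≈ _ L≡L' _ = L≡L'
    ... | tri> _ _ L'<L =
      ⊥-elim (proj₁ (moves r L' L'<L) (subst Halted (sym (prefix L' (<⇒≤ L'<L) ≤-refl)) (halts r')))

-- A witness lists configurations c₀ … c_L, where
-- c₀ is the initial configuration for x⃗, each earlier configuration is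
-- unhalted and followed by its successor, and c_L is halted; by Runs the two
-- lists end in the same configuration, from which U reads the output.
module KleeneT where
  open Evaluation

  eval-add-zero : ∀ x y → eval addC (x ∷ y ∷ []) ≡ 0 → x ≡ 0 × y ≡ 0
  eval-add-zero zero y h = refl , h
  eval-add-zero (suc x) y ()

  eval-pred : ∀ x → eval predC (x ∷ []) ≡ pred x
  eval-pred zero = refl
  eval-pred (suc x) = refl

  eval-dsub : ∀ y x → eval dsubC (y ∷ x ∷ []) ≡ x ∸ y
  eval-dsub zero x = refl
  eval-dsub (suc y) x = trans (eval-pred (eval dsubC (y ∷ x ∷ [])))
    (trans (cong pred (eval-dsub y x)) (pred[m∸n]≡m∸[1+n] x y))

  eval-nsg-zero : ∀ x → eval nsgC (x ∷ []) ≡ 0 → ¬ x ≡ 0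
  eval-nsg-zero zero () _
  eval-nsg-zero (suc x) _ ()

  eval-bsum-zero : ∀ (q : PR 3) b e y → eval (bsum q) (b ∷ e ∷ y ∷ []) ≡ 0 →
                   ∀ i → i < b → eval q (i ∷ e ∷ y ∷ []) ≡ 0
  eval-bsum-zero q (suc b) e y h i (s≤s i≤b) with eval-add-zero _ _ h | m<1+n⇒m<n∨m≡n (s≤s i≤b)
  ... | earlier , _ | inj₁ i<b = eval-bsum-zero q b e y earlier i i<b
  ... | _ , last | inj₂ refl = last

  ⊕-zero : ∀ {m} (a b : PR m) env → ev (a ⊕ b) env ≡ 0 → ev a env ≡ 0 × ev b env ≡ 0
  ⊕-zero a b env h = eval-add-zero _ _ (trans (sym (ev≡eval addC (ev a env ∷ ev b env ∷ []))) h)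

  eqP-zero : ∀ {m} (a b : PR m) env → ev (eqP a b) env ≡ 0 → ev a env ≡ ev b env
  eqP-zero a b env h with ⊕-zero (a ⊖ b) (b ⊖ a) env h
  ... | a∸b , b∸a =
    ≤-antisym (m∸n≡0⇒m≤n (trans (sym (difference b a)) a∸b)) (m∸n≡0⇒m≤n (trans (sym (difference a b)) b∸a))
    where
    difference : ∀ u v → ev (v ⊖ u) env ≡ ev v env ∸ ev u env
    difference u v = trans (ev≡eval dsubC (ev u env ∷ ev v env ∷ [])) (eval-dsub (ev u env) (ev v env))

  nsg-zero : ∀ {m} (a : PR m) env → ev (nsg a) env ≡ 0 → ¬ ev a env ≡ 0
  nsg-zero a env h = eval-nsg-zero (ev a env) (trans (sym (ev≡eval nsgC (ev a env ∷ []))) h)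

  bsum-zero : ∀ (q : PR 3) b e y → ev (bsum q) (b ∷ e ∷ y ∷ []) ≡ 0 → ∀ i → i < b → ev q (i ∷ e ∷ y ∷ []) ≡ 0
  bsum-zero q b e y h i i<b =
    trans (ev≡eval q _) (eval-bsum-zero q b e y (trans (sym (ev≡eval (bsum q) _)) h) i i<b)

  cfgAt : ℕ → ℕ → ℕ
  cfgAt y i = ev (nthP v0 v1) (y ∷ i ∷ [])

  lastIx : ℕ → ℕ
  lastIx y = ev (ap1 lenC v0 ⊖ K1) (y ∷ [])

  Halted : ℕ → ℕ → Set
  Halted e c = ev haltedC (e ∷ c ∷ []) ≡ 0

  next : ℕ → ℕ → ℕ
  next e c = ev stepC (e ∷ c ∷ [])

  readOutput : PR 1
  readOutput = cond (hsP v0) K0 (ap1 countC (rtP v0))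

  ev-encP-resp : ∀ {m k} (as : Vec (PR m) k) {env env'} → evs as env ≡ evs as env' → ev (encP as) env ≡ ev (encP as) env'
  ev-encP-resp [] p = refl
  ev-encP-resp (a ∷ as) p =
    cong₂ (λ x r → ev encodeStep (x ∷ r ∷ [])) (∷-injectiveˡ p) (ev-encP-resp as (∷-injectiveʳ p))
    where
    encodeStep : PR 2
    encodeStep = (ap1 pow2C (S' v0) ⊖ K1) ⊕ ap1 pow2C (S' (S' v0)) ⊗ v1

  evs-params : ∀ {n} e y (xs : Vec ℕ n) → evs (params {n}) (e ∷ y ∷ xs) ≡ xs
  evs-params {n} e y xs = trans (evs-tabulate (λ i → Pj (fsuc (fsuc i)))) (tabulate∘lookup xs)
    where
    evs-tabulate : ∀ {k} (hs : Fin k → PR (suc (suc n))) →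
                   evs (tabulate hs) (e ∷ y ∷ xs) ≡ tabulate (λ i → ev (hs i) (e ∷ y ∷ xs))
    evs-tabulate {zero} hs = refl
    evs-tabulate {suc k} hs = cong (ev (hs fzero) (e ∷ y ∷ xs) ∷_) (evs-tabulate (λ i → hs (fsuc i)))

  -- It is stated for arbitrary H and S
  -- so that the large codes haltedC and stepC are never unfolded.
  summand : PR 2 → PR 2 → PR 3
  summand H S = nsg (ap2 H v1 (nthP v2 v0)) ⊕ eqP (nthP v2 (S' v0)) (ap2 S v1 (nthP v2 v0))

  summand-zero : ∀ H S i e y → ev (summand H S) (i ∷ e ∷ y ∷ []) ≡ 0 →
                 ¬ ev H (e ∷ cfgAt y i ∷ []) ≡ 0 × cfgAt y (suc i) ≡ ev S (e ∷ cfgAt y i ∷ [])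
  summand-zero H S i e y h =
    nsg-zero (ap2 H v1 (nthP v2 v0)) (i ∷ e ∷ y ∷ []) (proj₁ parts) ,
    eqP-zero (nthP v2 (S' v0)) (ap2 S v1 (nthP v2 v0)) (i ∷ e ∷ y ∷ []) (proj₂ parts)
    where
    parts = ⊕-zero (nsg (ap2 H v1 (nthP v2 v0))) (eqP (nthP v2 (S' v0)) (ap2 S v1 (nthP v2 v0))) (i ∷ e ∷ y ∷ []) h

  -- T(e, y, x⃗) is, by definition, AP ⊕ BP ⊕ CP ⊕ DP ⊕ EP with these summands
  module Witness (n : ℕ) where
    eP yP NP initP LP : PR (suc (suc n))
    eP = v0
    yP = v1
    NP = encP params
    initP = cfgP K0 K0 (ap1 mod2C NP) (ap1 div2C NP)
    LP = ap1 lenC yP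
    AP BP CP DP EP : PR (suc (suc n))
    AP = ap2 iterC LP yP
    BP = nsg LP
    CP = eqP (nthP yP K0) initP
    DP = C (bsum (summand haltedC stepC)) ((LP ⊖ K1) ∷ eP ∷ yP ∷ [])
    EP = ap2 haltedC eP (nthP yP (LP ⊖ K1))

    initial-indep : ∀ e y y' (xs : Vec ℕ n) → ev initP (e ∷ y ∷ xs) ≡ ev initP (e ∷ y' ∷ xs)
    initial-indep e y y' xs = cong (λ N → ev (cfgP K0 K0 (ap1 mod2C v0) (ap1 div2C v0)) (N ∷ []))
      (ev-encP-resp params (trans (evs-params e y xs) (sym (evs-params e y' xs))))

    open Runs

    witness-run : ∀ e y (xs : Vec ℕ n) → ev (TC n) (e ∷ y ∷ xs) ≡ 0 →
      cfgAt y 0 ≡ ev initP (e ∷ y ∷ xs) × HaltingRun (Halted e) (next e) (cfgAt y) (lastIx y)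
    witness-run e y xs h =
      eqP-zero (nthP yP K0) initP (e ∷ y ∷ xs) (proj₂ upToC) , record { moves = moves ; halts = proj₂ upToE }
      where
      upToE = ⊕-zero (AP ⊕ BP ⊕ CP ⊕ DP) EP (e ∷ y ∷ xs) h
      upToD = ⊕-zero (AP ⊕ BP ⊕ CP) DP (e ∷ y ∷ xs) (proj₁ upToE)
      upToC = ⊕-zero (AP ⊕ BP) CP (e ∷ y ∷ xs) (proj₁ upToD)
      moves : ∀ i → i < lastIx y → ¬ Halted e (cfgAt y i) × cfgAt y (suc i) ≡ next e (cfgAt y i)
      moves i i<L =
        summand-zero haltedC stepC i e y (bsum-zero (summand haltedC stepC) (lastIx y) e y (proj₂ upToD) i i<L)

  T-functional : ∀ n e y y' (xs : Vec ℕ n) → eval (TC n) (e ∷ y ∷ xs) ≡ 0 → eval (TC n) (e ∷ y' ∷ xs) ≡ 0 →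
                 eval UC (y ∷ []) ≡ eval UC (y' ∷ [])
  T-functional n e y y' xs h h' =
    trans (sym (ev≡eval UC (y ∷ []))) (trans (cong (λ c → ev readOutput (c ∷ [])) same-end) (ev≡eval UC (y' ∷ [])))
    where
    open Witness n
    w = witness-run e y xs (trans (ev≡eval (TC n) _) h)
    w' = witness-run e y' xs (trans (ev≡eval (TC n) _) h')
    same-end : cfgAt y (lastIx y) ≡ cfgAt y' (lastIx y')
    same-end = Runs.runs-agree (Halted e) (next e)
      (trans (proj₁ w) (trans (initial-indep e y y' xs) (sym (proj₁ w')))) (proj₂ w) (proj₂ w')

-- a function of arity m extended by 0 to every arity a, to interpret the
-- symbols usr i a, whose arity is not fixed by their index i
atArity : (m : ℕ) → (Vec ℕ m → ℕ) → (a : ℕ) → Vec ℕ a → ℕ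
atArity m h a xs with a ≟ m
... | yes refl = h xs
... | no _ = 0

atArity-same : ∀ m h (xs : Vec ℕ m) → atArity m h m xs ≡ h xs
atArity-same m h xs with m ≟ m
... | yes refl = refl
... | no m≢m = ⊥-elim (m≢m refl)

module Construction (n : ℕ) (f : Vec ℕ n → ℕ) (e : ℕ) (computes-f : TMComputes n e f)
                    (pa-proof : PReqs ⊢ all^ n (ex' (Tform n e))) where
  open SubstitutionAlgebra
  open Evaluation

  g k : Sym
  g = usr 0 n
  k = usr 1 (suc (suc n))

  X : Vec Term n
  X = xvars n

  T-term : Term
  T-term = app (prf (TC n)) (numeral e ∷ var 0 ∷ X)

  g-equation : Equation
  g-equation = app g X ≈ app k (T-term ∷ var 0 ∷ X)

  data Prog : Equation → Set where
    pr-eq : ∀ {E} → PReqs E → Prog E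
    graph : ∀ ns → Prog (app g (map numeral ns) ≈ numeral (f ns))
    g-def : Prog g-equation
    k-def : Prog (app k (zeroT ∷ var 0 ∷ X) ≈ app (prf UC) (var 0 ∷ []))

  hasPR : ∀ {m} (c : PR m) {E} → DefEq c E → Prog E
  hasPR c d = pr-eq (_ , c , d)

  open BasicReasoning Prog
  open PRTotality Prog hasPR
  open Translation Prog hasPR

  -- the variables x⃗ of T(e, x⃗, y) are distinct from the witness variable 0
  X-lift : substV (lift shift) X ≡ substV shift X
  X-lift = trans (substV-tab (lift shift) (λ i → n ∸ toℕ i))
    (trans (tabulate-cong (λ i → positive (toℕ i) n (toℕ<n i))) (sym (substV-tab shift (λ i → n ∸ toℕ i))))
    where
    positive : ∀ i m → i < m → lift shift (m ∸ i) ≡ shift (m ∸ i)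
    positive zero (suc m) _ = refl
    positive (suc i) (suc m) (s≤s i<m) = positive i m i<m

  -- from T(e, y, x⃗) = 0: g(x⃗) = k(T(e, y, x⃗), y, x⃗) = k(0, y, x⃗) = U(y), and U(y) has a value
  g-from-T : ∀ {Δ} → Δ ⊢ᵇ ex' (Tform n e) → Δ ⊢ᵇ ex' (app g X ≐ var 0)
  g-from-T {Δ} d = ∃E d (cast (cong (λ v → ex' (app g v ≐ var 0)) (sym X-lift))
    (↓-≐ (≐-trans (axEq g-def) (≐-trans T-vanishes (axEq k-def))) (app↓ (prf-total UC) (↓-var 0 ∷ []))))
    where
    T-vanishes : Tform n e ∷ mapL ↑ Δ ⊢ᵇ app k (T-term ∷ var 0 ∷ X) ≐ app k (zeroT ∷ var 0 ∷ X)
    T-vanishes = cast (cong₂ (λ u v → app k (T-term ∷ var 0 ∷ u) ≐ app k (zeroT ∷ var 0 ∷ v))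
                             (inst-shiftV T-term X) (inst-shiftV zeroT X))
      (≐-cong (app k (var 0 ∷ var 1 ∷ substV shift X)) (hyp (here refl)))

  g-total : Prog ⊢b Total g refl
  g-total = all^-map g-from-T n (translate pa-proof)

  k-value : Vec ℕ (suc (suc n)) → ℕ
  k-value (zero ∷ y ∷ xs) = ev UC (y ∷ [])
  k-value (suc _ ∷ y ∷ xs) = f xs

  I : (s : Sym) → Vec ℕ (arity s) → ℕ
  I 𝟘 [] = 0
  I 𝕊 (x ∷ []) = suc x
  I (prf c) xs = ev c xs
  I (usr zero a) = atArity n f a
  I (usr (suc zero) a) = atArity (suc (suc n)) k-value a
  I (usr (suc (suc _)) a) _ = 0

  open Semantics I

  sem-numeral : ∀ m ρ → ⟦ numeral m ⟧ ρ ≡ m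
  sem-numeral zero ρ = refl
  sem-numeral (suc m) ρ = cong suc (sem-numeral m ρ)

  sem-numerals : ∀ {a} (ns : Vec ℕ a) ρ → ⟦ map numeral ns ⟧V ρ ≡ ns
  sem-numerals [] ρ = refl
  sem-numerals (m ∷ ns) ρ = cong₂ _∷_ (sem-numeral m ρ) (sem-numerals ns ρ)

  sem-vars : ∀ {a} (h : Fin a → ℕ) ρ → ⟦ tabulate (λ i → var (h i)) ⟧V ρ ≡ tabulate (λ i → ρ (h i))
  sem-vars {zero} h ρ = refl
  sem-vars {suc a} h ρ = cong (ρ (h fzero) ∷_) (sem-vars (λ i → h (fsuc i)) ρ)

  defEq-true : ∀ {m} {c : PR m} {E} → DefEq c E → ∀ ρ → ⟦ lhs E ⟧ ρ ≡ ⟦ rhs E ⟧ ρ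
  defEq-true dZ ρ = refl
  defEq-true dS ρ = refl
  defEq-true (dP i) ρ = trans (cong (λ v → lookup v i) (sem-vars toℕ ρ))
    (trans (lookup∘tabulate (λ j → ρ (toℕ j)) i) (cong (λ t → ⟦ t ⟧ ρ) (sym (lookup∘tabulate (λ j → var (toℕ j)) i))))
  defEq-true {m} (dC g' hs) ρ = cong (ev g') (components hs)
    where
    components : ∀ {j} (hs : Vec (PR m) j) → evs hs (⟦ vars m ⟧V ρ) ≡ ⟦ map (λ h → app (prf h) (vars m)) hs ⟧V ρ
    components [] = refl
    components (h ∷ hs) = cong (_ ∷_) (components hs)
  defEq-true {suc m} (dR0 g' h) ρ = ev-R-zero g' h (⟦ vars m ⟧V ρ)
  defEq-true {suc m} (dR1 g' h) ρ = ev-R-suc g' h (ρ m) (⟦ vars m ⟧V ρ)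

  -- k computes f at every witness of T: by determinism U(y) = f(x⃗) there
  k-correct : ∀ t y xs → ev (TC n) (e ∷ y ∷ xs) ≡ t → f xs ≡ k-value (t ∷ y ∷ xs)
  k-correct zero y xs T≡0 =
    trans (sym (proj₂ (proj₂ (computes-f xs))))
      (trans (KleeneT.T-functional n e (proj₁ (computes-f xs)) y xs (proj₁ (proj₂ (computes-f xs)))
                                   (trans (sym (ev≡eval (TC n) (e ∷ y ∷ xs))) T≡0))
             (sym (ev≡eval UC (y ∷ []))))
  k-correct (suc t) y xs _ = refl

  Prog-true : ∀ {E} → Prog E → ∀ ρ → ⟦ lhs E ⟧ ρ ≡ ⟦ rhs E ⟧ ρ
  Prog-true (pr-eq (m , c , d)) ρ = defEq-true d ρ
  Prog-true (graph ns) ρ =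
    trans (atArity-same n f _) (trans (cong f (sem-numerals ns ρ)) (sym (sem-numeral (f ns) ρ)))
  Prog-true g-def ρ =
    trans (atArity-same n f xs) (trans (k-correct (⟦ T-term ⟧ ρ) (ρ 0) xs T-value) (sym (atArity-same _ k-value _)))
    where
    xs = ⟦ X ⟧V ρ
    T-value : ev (TC n) (e ∷ ρ 0 ∷ xs) ≡ ⟦ T-term ⟧ ρ
    T-value = cong (λ z → ev (TC n) (z ∷ ρ 0 ∷ xs)) (sym (sem-numeral e ρ))
  Prog-true k-def ρ = atArity-same _ k-value _

  open Soundness Prog Prog-true refl (λ _ → refl)

  -- 𝐀(Prog) holds in the model, so it is consistent
  strongly-coherent : StronglyCoherent Prog
  strongly-coherent = consistent

  g-occurs : OccursIn Prog g
  g-occurs = g-equation , g-def , inj₁ (inj₁ refl)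

  full : Full Prog
  full c _ E d = hasPR c d

  computes : Computes Prog g refl f
  computes ns m = derived⇒graph , graph⇒derived
    where
    derived⇒graph : Prog ⊢₌ (app g (map numeral ns) ≈ numeral m) → f ns ≡ m
    derived⇒graph d = trans (sym (trans (atArity-same n f _) (cong f (sem-numerals ns (λ _ → 0)))))
                            (trans (eq-sound d (λ _ → 0)) (sem-numeral m (λ _ → 0)))
    graph⇒derived : f ns ≡ m → Prog ⊢₌ (app g (map numeral ns) ≈ numeral m)
    graph⇒derived refl = mem (graph ns)

theorem4 : (n : ℕ) (f : Vec ℕ n → ℕ) → ProvablyRecursive n f →
    Σ (Equation → Set) (λ P → Σ Sym (λ g → Σ (arity g ≡ n) (λ eq →
    OccursIn P g × StronglyCoherent P × Full P × Computes P g eq f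
    × (P ⊢b Total g eq))))
theorem4 n f (e , computes-f , pa-proof) =
  Prog , g , refl , g-occurs , strongly-coherent , full , computes , g-total
  where open Construction n f e computes-f pa-proof
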